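{- Let $\phi$ be a linear formula on a finite set of variables $\mathcal{V}_1$ and $\psi$ a linear formula on a finite set of variables $\mathcal{V}_2$, and suppose $\phi \to \psi$ is a linear inference. If $|\mathcal{V}_1 \cap \mathcal{V}_2| \leq 7$, then $\phi$ is $\{\mathsf{s},\mathsf{m}\}$-derivable with units to $\psi$. Furthermore, there exists a linear inference $\phi \to \psi$ on $8$ variables such that $\psi$ is not $\{\mathsf{s},\mathsf{m}\}$-derivable with units from $\phi$; hence $7$ is the largest number with the property above.
   Context: Fix a countably infinite set of variables. Linear formulae on a finite set $\mathcal{V}$ of variables are defined inductively: - $\top$ and $\bot$ are linear formulae on $\emptyset$. - For a variable $x$, both $x$ and $\neg x$ are linear formulae on $\{x\}$. - If $\phi$ is on $\mathcal{V}_1$, $\psi$ is on $\mathcal{V}_2$ and $\mathcal{V}_1 \cap \mathcal{V}_2 = \emptyset$, then $\phi \lor \psi$ and $\phi \land \psi$ are linear formulae on $\mathcal{V}_1 \cup \mathcal{V}_2$. Formulae are evaluated under assignments $\alpha$ from variables to $\{0,1\}$ in the usual Boolean way. A linear inference is a pair $\phi \to \psi$ of linear formulae, possibly on different variable sets, such that every assignment satisfying $\phi$ also satisfies $\psi$. An inference is on $n$ variables if both sides are linear formulae on a common set $\mathcal{V}$ with $|\mathcal{V}| = n$. A congruence is an equivalence relation on linear formulae closed under contexts: $\phi \sim \psi$ implies $\phi \land \chi \sim \psi\land\chi$, $\chi\land\phi\sim\chi\land\psi$, and the same for $\lor$. - $\sim_{\mathsf{ac}}$ is the smallest congruence containing commutativity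 and associativity of $\land$ and of $\lor$. - $\sim_{\mathsf{u}}$ is the smallest congruence containing $\phi\land\top\sim\phi$, $\top\land\phi\sim\phi$, $\phi\lor\bot\sim\phi$, $\bot\lor\phi\sim\phi$, $\phi\land\bot\sim\bot$, $\bot\land\phi\sim\bot$, $\phi\lor\top\sim\top$ and $\top\lor\phi\sim\top$. - $\sim_{\mathsf{acu}}$ is the smallest congruence containing both $\sim_{\mathsf{ac}}$ and $\sim_{\mathsf{u}}$. For a set $S$ of linear inferences, $\to_S$ is the smallest relation containing each inference of $S$ and closed under substitution of linear formulae for variables (keeping linearity) and under contexts. Write $\phi \rightsquigarrow_{S\mathsf{u}} \psi$ if there are $\phi',\psi'$ with $\phi \sim_{\mathsf{acu}} \phi' \to_S \psi' \sim_{\mathsf{acu}} \psi$. The inference $\phi\to\psi$ is $S$-derivable with units if $\phi$ and $\psi$ are related by the reflexive-transitive closure of $\rightsquigarrow_{S\mathsf{u}} \cup \sim_{\mathsf{acu}}$. Switch $\mathsf{s}$ is the inference $x \land (y \lor z) \to (x\land y)\lor z$, and medial $\mathsf{m}$ is the inference $(w\land x)\lor(y\land z) \to (w\lor y)\land(x\lor z)$. -}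

module Defs where

import Data.Bool as Bool
open import Data.Bool using (Bool; true; false; not)
open import Data.List using (List; []; _∷_; [_]; _++_; filter)
open import Data.List.Membership.DecPropositional using () renaming (_∈?_ to mem?)
open import Data.List.Relation.Binary.Disjoint.Propositional using (Disjoint)
open import Data.List.Relation.Binary.Permutation.Propositional using (_↭_; ↭-refl; ↭-sym; ↭⇒↭ₛ)
import Data.List.Relation.Binary.Permutation.Setoid.Properties as PermS
open import Data.List.Relation.Unary.All using ([]; _∷_)
open import Data.List.Relation.Unary.AllPairs using ([]; _∷_)
open import Data.List.Relation.Unary.Any using (here; there)
open import Data.List.Relation.Unary.Unique.Propositional using (Unique)
import Data.List.Relation.Unary.Unique.Propositional.Properties as Uniq
open import Data.Nat using (ℕ; _≟_)
open import Data.Product using (∃; _×_; _,_)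
open import Level using (0ℓ)
open import Relation.Binary.Construct.Closure.ReflexiveTransitive using (Star)
open import Relation.Binary.Construct.Union using (_∪_)
open import Relation.Binary.Core using (Rel)
open import Relation.Binary.PropositionalEquality using (_≡_; refl; setoid)

infixr 7 _∧_
infixr 6 _∨_

data Formula : Set where
  ⊤ ⊥     : Formula
  var neg : ℕ → Formula
  _∧_ _∨_ : Formula → Formula → Formula

-- A finite set of variables is a list without repetitions, in any order.
-- Hence the union of two disjoint sets U and V is represented by every
-- permutation of U ++ V, and cardinality is length.
VarSet : Set
VarSet = List ℕ

_∩_ : VarSet → VarSet → VarSet
U ∩ V = filter (λ x → mem? _≟_ x V) U

infix 4 _LinearOn_

data _LinearOn_ : Formula → VarSet → Set where
  ⊤-on   : ⊤ LinearOn []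
  ⊥-on   : ⊥ LinearOn []
  var-on : ∀ x → var x LinearOn [ x ]
  neg-on : ∀ x → neg x LinearOn [ x ]
  ∧-on   : ∀ {φ ψ U V W} → φ LinearOn U → ψ LinearOn V →
           Disjoint U V → W ↭ U ++ V → φ ∧ ψ LinearOn W
  ∨-on   : ∀ {φ ψ U V W} → φ LinearOn U → ψ LinearOn V →
           Disjoint U V → W ↭ U ++ V → φ ∨ ψ LinearOn W

-- The index of _LinearOn_ never has repetitions.
linearOn-unique : ∀ {φ V} → φ LinearOn V → Unique V
linearOn-unique ⊤-on       = []
linearOn-unique ⊥-on       = []
linearOn-unique (var-on x) = [] ∷ []
linearOn-unique (neg-on x) = [] ∷ []
linearOn-unique (∧-on p q d r) =
  PermS.Unique-resp-↭ (setoid ℕ) (↭⇒↭ₛ (↭-sym r))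
    (Uniq.++⁺ (linearOn-unique p) (linearOn-unique q) d)
linearOn-unique (∨-on p q d r) =
  PermS.Unique-resp-↭ (setoid ℕ) (↭⇒↭ₛ (↭-sym r))
    (Uniq.++⁺ (linearOn-unique p) (linearOn-unique q) d)

Linear : Formula → Set
Linear φ = ∃ λ V → φ LinearOn V

Assignment : Set
Assignment = ℕ → Bool

eval : Assignment → Formula → Bool
eval α ⊤       = true
eval α ⊥       = false
eval α (var x) = α x
eval α (neg x) = not (α x)
eval α (φ ∧ ψ) = eval α φ Bool.∧ eval α ψ
eval α (φ ∨ ψ) = eval α φ Bool.∨ eval α ψ

infix 4 _⊨_

_⊨_ : Formula → Formula → Set
φ ⊨ ψ = ∀ α → eval α φ ≡ true → eval α ψ ≡ true

IsLinearInference : Formula → Formula → Set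
IsLinearInference φ ψ = Linear φ × Linear ψ × φ ⊨ ψ

-- The smallest congruence on linear formulae containing R.  Formulae are raw,
-- so linearity of the two sides is required wherever it is not inherited from
-- the premises; related formulae are always linear.
data Congruence (R : Rel Formula 0ℓ) : Rel Formula 0ℓ where
  base    : ∀ {φ ψ} → Linear φ → Linear ψ → R φ ψ → Congruence R φ ψ
  reflex  : ∀ {φ} → Linear φ → Congruence R φ φ
  symm    : ∀ {φ ψ} → Congruence R φ ψ → Congruence R ψ φ
  transit : ∀ {φ ψ χ} → Congruence R φ ψ → Congruence R ψ χ → Congruence R φ χ
  ∧-congˡ : ∀ {φ ψ χ} → Linear (φ ∧ χ) → Linear (ψ ∧ χ) →
            Congruence R φ ψ → Congruence R (φ ∧ χ) (ψ ∧ χ)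
  ∧-congʳ : ∀ {φ ψ χ} → Linear (χ ∧ φ) → Linear (χ ∧ ψ) →
            Congruence R φ ψ → Congruence R (χ ∧ φ) (χ ∧ ψ)
  ∨-congˡ : ∀ {φ ψ χ} → Linear (φ ∨ χ) → Linear (ψ ∨ χ) →
            Congruence R φ ψ → Congruence R (φ ∨ χ) (ψ ∨ χ)
  ∨-congʳ : ∀ {φ ψ χ} → Linear (χ ∨ φ) → Linear (χ ∨ ψ) →
            Congruence R φ ψ → Congruence R (χ ∨ φ) (χ ∨ ψ)

data ACAxiom : Rel Formula 0ℓ where
  ∧-comm  : ∀ φ ψ → ACAxiom (φ ∧ ψ) (ψ ∧ φ)
  ∨-comm  : ∀ φ ψ → ACAxiom (φ ∨ ψ) (ψ ∨ φ)
  ∧-assoc : ∀ φ ψ χ → ACAxiom ((φ ∧ ψ) ∧ χ) (φ ∧ (ψ ∧ χ))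
  ∨-assoc : ∀ φ ψ χ → ACAxiom ((φ ∨ ψ) ∨ χ) (φ ∨ (ψ ∨ χ))

data UnitAxiom : Rel Formula 0ℓ where
  ∧-⊤ʳ : ∀ φ → UnitAxiom (φ ∧ ⊤) φ
  ∧-⊤ˡ : ∀ φ → UnitAxiom (⊤ ∧ φ) φ
  ∨-⊥ʳ : ∀ φ → UnitAxiom (φ ∨ ⊥) φ
  ∨-⊥ˡ : ∀ φ → UnitAxiom (⊥ ∨ φ) φ
  ∧-⊥ʳ : ∀ φ → UnitAxiom (φ ∧ ⊥) ⊥
  ∧-⊥ˡ : ∀ φ → UnitAxiom (⊥ ∧ φ) ⊥
  ∨-⊤ʳ : ∀ φ → UnitAxiom (φ ∨ ⊤) ⊤
  ∨-⊤ˡ : ∀ φ → UnitAxiom (⊤ ∨ φ) ⊤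

infix 4 _∼ac_ _∼u_ _∼acu_

_∼ac_ _∼u_ _∼acu_ : Rel Formula 0ℓ
_∼ac_  = Congruence ACAxiom
_∼u_   = Congruence UnitAxiom
_∼acu_ = Congruence (_∼ac_ ∪ _∼u_)

-- De Morgan dual: what a negated variable becomes under a substitution.
dual : Formula → Formula
dual ⊤       = ⊥
dual ⊥       = ⊤
dual (var x) = neg x
dual (neg x) = var x
dual (φ ∧ ψ) = dual φ ∨ dual ψ
dual (φ ∨ ψ) = dual φ ∧ dual ψ

infix 8 _⟨_⟩

_⟨_⟩ : Formula → (ℕ → Formula) → Formula
⊤       ⟨ σ ⟩ = ⊤
⊥       ⟨ σ ⟩ = ⊥
var x   ⟨ σ ⟩ = σ x
neg x   ⟨ σ ⟩ = dual (σ x)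
(φ ∧ ψ) ⟨ σ ⟩ = φ ⟨ σ ⟩ ∧ ψ ⟨ σ ⟩
(φ ∨ ψ) ⟨ σ ⟩ = φ ⟨ σ ⟩ ∨ ψ ⟨ σ ⟩

-- Only those pairs in S that are linear inferences are used, so S may be any
-- relation; related formulae are again always linear.
data Step (S : Rel Formula 0ℓ) : Rel Formula 0ℓ where
  rule  : ∀ {φ ψ} → IsLinearInference φ ψ → S φ ψ → Step S φ ψ
  inst  : ∀ {φ ψ} (σ : ℕ → Formula) → (∀ x → Linear (σ x)) →
          Linear (φ ⟨ σ ⟩) → Linear (ψ ⟨ σ ⟩) →
          Step S φ ψ → Step S (φ ⟨ σ ⟩) (ψ ⟨ σ ⟩)
  ∧-ctxˡ : ∀ {φ ψ χ} → Linear (φ ∧ χ) → Linear (ψ ∧ χ) →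
           Step S φ ψ → Step S (φ ∧ χ) (ψ ∧ χ)
  ∧-ctxʳ : ∀ {φ ψ χ} → Linear (χ ∧ φ) → Linear (χ ∧ ψ) →
           Step S φ ψ → Step S (χ ∧ φ) (χ ∧ ψ)
  ∨-ctxˡ : ∀ {φ ψ χ} → Linear (φ ∨ χ) → Linear (ψ ∨ χ) →
           Step S φ ψ → Step S (φ ∨ χ) (ψ ∨ χ)
  ∨-ctxʳ : ∀ {φ ψ χ} → Linear (χ ∨ φ) → Linear (χ ∨ ψ) →
           Step S φ ψ → Step S (χ ∨ φ) (χ ∨ ψ)

StepU : Rel Formula 0ℓ → Rel Formula 0ℓ
StepU S φ ψ = ∃ λ φ′ → ∃ λ ψ′ → φ ∼acu φ′ × Step S φ′ ψ′ × ψ′ ∼acu ψ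

DerivableWithUnits : Rel Formula 0ℓ → Rel Formula 0ℓ
DerivableWithUnits S = Star (StepU S ∪ _∼acu_)

-- The variables w, x, y, z of the two rules are 0, 1, 2, 3.
data SwitchMedial : Rel Formula 0ℓ where
  switch : SwitchMedial (var 1 ∧ (var 2 ∨ var 3))
                        ((var 1 ∧ var 2) ∨ var 3)
  medial : SwitchMedial ((var 0 ∧ var 1) ∨ (var 2 ∧ var 3))
                        ((var 0 ∨ var 2) ∧ (var 1 ∨ var 3))

switchMedial-isLinearInference :
  ∀ {φ ψ} → SwitchMedial φ ψ → IsLinearInference φ ψ
switchMedial-isLinearInference switch =
  (_ , ∧-on (var-on 1)
            (∨-on (var-on 2) (var-on 3) (λ { (here refl , here ()) }) ↭-refl)
            (λ { (here refl , here ()) ; (here refl , there (here ())) })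
            ↭-refl) ,
  (_ , ∨-on (∧-on (var-on 1) (var-on 2) (λ { (here refl , here ()) }) ↭-refl)
            (var-on 3)
            (λ { (here refl , here ()) ; (there (here refl) , here ()) })
            ↭-refl) ,
  sound
  where
  sound : var 1 ∧ (var 2 ∨ var 3) ⊨ (var 1 ∧ var 2) ∨ var 3
  sound α e with α 1 | α 2 | α 3
  ... | true | true  | _    = refl
  ... | true | false | true = refl
switchMedial-isLinearInference medial =
  (_ , ∨-on (∧-on (var-on 0) (var-on 1) (λ { (here refl , here ()) }) ↭-refl)
            (∧-on (var-on 2) (var-on 3) (λ { (here refl , here ()) }) ↭-refl)
            (λ { (here refl , here ()) ; (here refl , there (here ()))
               ; (there (here refl) , here ())
               ; (there (here refl) , there (here ())) })
            ↭-refl) ,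
  (_ , ∧-on (∨-on (var-on 0) (var-on 2) (λ { (here refl , here ()) }) ↭-refl)
            (∨-on (var-on 1) (var-on 3) (λ { (here refl , here ()) }) ↭-refl)
            (λ { (here refl , here ()) ; (here refl , there (here ()))
               ; (there (here refl) , here ())
               ; (there (here refl) , there (here ())) })
            ↭-refl) ,
  sound
  where
  sound : (var 0 ∧ var 1) ∨ (var 2 ∧ var 3) ⊨ (var 0 ∨ var 2) ∧ (var 1 ∨ var 3)
  sound α e with α 0 | α 1 | α 2 | α 3
  ... | true  | true  | _    | _    = refl
  ... | true  | false | true | true = refl
  ... | false | true  | true | true = refl
  ... | false | false | true | true = refl

{-# OPTIONS --safe #-}
-- Let φ imply ψ.  A conjunction ψ₁ ∧ ψ₂ on the right, and dually a disjunction on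
-- the left, is split up: by medials φ derives φ₁ ∧ φ₂, where φᵢ is φ with ⊤ for
-- the variables outside ψᵢ, and φᵢ implies ψᵢ.  If φ is x ∧ φ′, then φ′ implies
-- ψ[x := ⊤], and x ∧ ψ[x := ⊤] derives ψ by switches.  If φ is φ₁ ∧ (φ₂ ∨ φ₃) with
-- φ₃ implying ψ, a switch leads to (φ₁ ∧ φ₂) ∨ φ₃, which still implies ψ and is a
-- disjunction.  On at most seven common variables one of these cases or its dual
-- always applies, which a search through all pairs of formulae up to
-- associativity, commutativity and renaming confirms.
--
-- For the inference on eight variables, the only linear formulae between the two
-- sides are, as functions of these variables, the sides themselves, again by a
-- search.  A derivation would therefore pass from one to the other in a single
-- step.  But some two variables meet in ∧ on the left and in ∨ on the right, and
-- another two the other way round, while a switch keeps all meets in ∨ and a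
-- medial all meets in ∧.
module Submission where

open import Defs
open import Data.Bool using (Bool; true; false; not; if_then_else_; T) renaming (_∧_ to _&&_; _∨_ to _||_)
import Data.Bool.Properties as 𝔹ₚ
open import Data.Empty using (⊥-elim) renaming (⊥ to Empty)
open import Data.List using (List; []; _∷_; [_]; _++_; length; filter; filterᵇ; map; concatMap; cartesianProductWith; upTo)
open import Data.List.Membership.DecPropositional using () renaming (_∈?_ to mem?)
open import Data.List.Membership.Propositional using (_∈_; find)
import Data.List.Membership.Propositional.Properties as ∈ₚ
import Data.List.Properties as Listₚ
open import Data.List.Relation.Binary.Permutation.Propositional using (_↭_; ↭-refl; ↭-sym; ↭-trans; ↭-prep)
import Data.List.Relation.Binary.Permutation.Propositional.Properties as ↭ₚ
open import Data.List.Relation.Unary.All using ([]; _∷_)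
import Data.List.Relation.Unary.All as All
import Data.List.Relation.Unary.All.Properties as Allₚ
open import Data.List.Relation.Unary.AllPairs using ([]; _∷_)
import Data.List.Relation.Unary.Any as Any
open import Data.List.Relation.Unary.Unique.Propositional using (Unique)
import Data.List.Relation.Unary.Unique.Propositional.Properties as Uniq
open import Data.Nat using (ℕ; zero; suc; _+_; _≤_; _<_; z≤n; s≤s; _≟_; _≡ᵇ_; _<ᵇ_)
import Data.Nat.Properties as ℕₚ
open import Data.Product using (∃; ∃₂; _×_; _,_; proj₁; proj₂)
open import Data.Sum using (_⊎_; inj₁; inj₂; [_,_]′)
open import Data.Unit using (tt) renaming (⊤ to Unit)
open import Function using (_∘_; id)
open import Level using (0ℓ)
open import Relation.Binary.Construct.Closure.ReflexiveTransitive using (Star; ε; _◅_; _◅◅_)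
import Relation.Binary.Construct.Closure.ReflexiveTransitive as Star
open import Relation.Binary.Core using (Rel)
open import Relation.Binary.PropositionalEquality using (_≡_; _≢_; refl; sym; trans; cong; cong₂; subst; subst₂)
open import Relation.Nullary using (¬_; Dec; yes; no; does; contradiction)
open import Relation.Nullary.Decidable using (dec-true; dec-false; _⊎-dec_; map′; ¬?; toWitness)

-- Derivations may pass only through linear formulae, yet the unit laws let them bring in variables
-- of neither side. So every derivation carries a bound on its variables, and two are put side by
-- side only under disjoint bounds. Signs are kept apart from shapes: a variable of a linear formula
-- has a single literal, so formulae become trees over unsigned atoms, which compute monotone
-- functions. A variable whose signs differ on the two sides is treated like one that occurs on one
-- side only: its literal becomes ⊤ on the left and ⊥ on the right. The induction runs on the total
-- number of atoms; the switch of the third case keeps this number, but the disjunction that it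
-- produces is split at once. In the negative half a derivation may pass through constants,
-- negations and further variables. Hence the connective in which two variables meet is read off
-- from the Boolean function, and literals other than the variables `0`, ..., `7` are made true
-- before the search applies.

-- Trees, linearity and evaluation

-- The connective of a node is a Boolean: true for ∧, false for ∨.  Then cst o
-- is the unit of connective o and cst (not o) its absorbing constant.
data Tree : Set where
  cst : Bool → Tree
  at  : ℕ → Tree
  nd  : Bool → Tree → Tree → Tree

private
  variable
    o b c : Bool
    x y : ℕ
    xs : List ℕ
    r s t u s′ t′ : Tree
    P Q R : ℕ → Set

op : Bool → Bool → Bool → Bool
op true  = _&&_
op false = _||_

ev : Assignment → Tree → Bool
ev β (cst b)    = b
ev β (at x)     = β x
ev β (nd o s t) = op o (ev β s) (ev β t)

infix 4 _∈ᵗ_ _∈ᵗ?_ _≤ᵗ_ _≈_ _↝_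

data _∈ᵗ_ (x : ℕ) : Tree → Set where
  here : x ∈ᵗ at x
  inˡ  : x ∈ᵗ s → x ∈ᵗ nd o s t
  inʳ  : x ∈ᵗ t → x ∈ᵗ nd o s t

_∈ᵗ?_ : ∀ x t → Dec (x ∈ᵗ t)
x ∈ᵗ? cst b    = no λ ()
x ∈ᵗ? at y     = map′ (λ { refl → here }) (λ { here → refl }) (x ≟ y)
x ∈ᵗ? nd o s t =
  map′ [ inˡ , inʳ ]′ (λ { (inˡ p) → inj₁ p ; (inʳ p) → inj₂ p })
       ((x ∈ᵗ? s) ⊎-dec (x ∈ᵗ? t))

fromDoes : ∀ {A : Set} (d : Dec A) → does d ≡ true → A
fromDoes (yes a) _ = a

size : Tree → ℕ
size (cst b)    = 0
size (at x)     = 1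
size (nd o s t) = size s + size t

_≤ᵗ_ : Tree → Tree → Set
s ≤ᵗ t = ∀ β → ev β s ≡ true → ev β t ≡ true

data Ok (P : ℕ → Set) : Tree → Set where
  cst : Ok P (cst b)
  at  : P x → Ok P (at x)
  nd  : Ok P s → Ok P t → (∀ {x} → x ∈ᵗ s → x ∈ᵗ t → Empty) → Ok P (nd o s t)

Ok-∈ : Ok P t → x ∈ᵗ t → P x
Ok-∈ (at p)     here    = p
Ok-∈ (nd p q d) (inˡ i) = Ok-∈ p i
Ok-∈ (nd p q d) (inʳ i) = Ok-∈ q i

Okˡ : Ok P (nd o s t) → Ok P s
Okˡ (nd p _ _) = p

Okʳ : Ok P (nd o s t) → Ok P t
Okʳ (nd _ q _) = q

Ok-restrict : Ok P t → (∀ {x} → x ∈ᵗ t → Q x) → Ok Q t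
Ok-restrict cst        f = cst
Ok-restrict (at p)     f = at (f here)
Ok-restrict (nd p q d) f = nd (Ok-restrict p (f ∘ inˡ)) (Ok-restrict q (f ∘ inʳ)) d

Ok-mono : (∀ {x} → P x → Q x) → Ok P t → Ok Q t
Ok-mono f p = Ok-restrict p (f ∘ Ok-∈ p)

Ok-self : Ok P t → Ok (_∈ᵗ t) t
Ok-self p = Ok-restrict p id

op-comm : ∀ o a b → op o a b ≡ op o b a
op-comm true  = 𝔹ₚ.∧-comm
op-comm false = 𝔹ₚ.∨-comm

op-assoc : ∀ o a b c → op o (op o a b) c ≡ op o a (op o b c)
op-assoc true  = 𝔹ₚ.∧-assoc
op-assoc false = 𝔹ₚ.∨-assoc

ev-cong : ∀ {β γ} t → (∀ {x} → x ∈ᵗ t → β x ≡ γ x) → ev β t ≡ ev γ t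
ev-cong (cst b)    f = refl
ev-cong (at x)     f = f here
ev-cong (nd o s t) f = cong₂ (op o) (ev-cong s (f ∘ inˡ)) (ev-cong t (f ∘ inʳ))

&&-true : ∀ {a b} → a && b ≡ true → a ≡ true × b ≡ true
&&-true {true} {true} _ = refl , refl

||-true : ∀ {a b} → a || b ≡ true → a ≡ true ⊎ b ≡ true
||-true {true}  e = inj₁ refl
||-true {false} e = inj₂ e

||-trueʳ : ∀ a {b} → b ≡ true → a || b ≡ true
||-trueʳ true  e = refl
||-trueʳ false e = e

||-trueˡ : ∀ {a} b → a ≡ true → a || b ≡ true
||-trueˡ b refl = refl

op-mono : ∀ o {a b a′ b′} → (a ≡ true → a′ ≡ true) → (b ≡ true → b′ ≡ true) →
          op o a b ≡ true → op o a′ b′ ≡ true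
op-mono true  {true} {true} f g e = cong₂ _&&_ (f refl) (g refl)
op-mono false {true}  {b} {b′ = b′} f g e = ||-trueˡ b′ (f refl)
op-mono false {false} {true} {a′} f g e = ||-trueʳ a′ (g refl)

ev-mono : ∀ {β γ} t → (∀ {x} → x ∈ᵗ t → β x ≡ true → γ x ≡ true) →
          ev β t ≡ true → ev γ t ≡ true
ev-mono (cst b)    f e = e
ev-mono (at x)     f e = f here e
ev-mono (nd o s t) f e = op-mono o (ev-mono s (f ∘ inˡ)) (ev-mono t (f ∘ inʳ)) e

-- Associativity and commutativity

data _≈_ : Tree → Tree → Set where
  ≈refl  : s ≈ s
  ≈trans : s ≈ t → t ≈ u → s ≈ u
  ≈comm  : nd o s t ≈ nd o t s
  ≈assoc : nd o (nd o s t) u ≈ nd o s (nd o t u)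
  ≈cong  : s ≈ s′ → t ≈ t′ → nd o s t ≈ nd o s′ t′

-- Two rotations by commutativity and associativity reverse associativity, so symmetry need not be a
-- constructor of `_≈_`.
≈assoc⁻ : nd o s (nd o t u) ≈ nd o (nd o s t) u
≈assoc⁻ = ≈trans ≈comm (≈trans ≈assoc (≈trans ≈comm (≈trans ≈assoc ≈comm)))

≈sym : s ≈ t → t ≈ s
≈sym ≈refl        = ≈refl
≈sym (≈trans p q) = ≈trans (≈sym q) (≈sym p)
≈sym ≈comm        = ≈comm
≈sym ≈assoc       = ≈assoc⁻
≈sym (≈cong p q)  = ≈cong (≈sym p) (≈sym q)

≈interchange : nd o (nd o r s) (nd o t u) ≈ nd o (nd o r t) (nd o s u)
≈interchange =
  ≈trans ≈assoc (≈trans (≈cong ≈refl (≈trans ≈assoc⁻ (≈trans (≈cong ≈comm ≈refl) ≈assoc))) ≈assoc⁻)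

≈-∈ : s ≈ t → x ∈ᵗ s → x ∈ᵗ t
≈-∈ ≈refl        i             = i
≈-∈ (≈trans p q) i             = ≈-∈ q (≈-∈ p i)
≈-∈ ≈comm        (inˡ i)       = inʳ i
≈-∈ ≈comm        (inʳ i)       = inˡ i
≈-∈ ≈assoc       (inˡ (inˡ i)) = inˡ i
≈-∈ ≈assoc       (inˡ (inʳ i)) = inʳ (inˡ i)
≈-∈ ≈assoc       (inʳ i)       = inʳ (inʳ i)
≈-∈ (≈cong p q)  (inˡ i)       = inˡ (≈-∈ p i)
≈-∈ (≈cong p q)  (inʳ i)       = inʳ (≈-∈ q i)

≈-Ok : s ≈ t → Ok P s → Ok P t
≈-Ok ≈refl        p = p
≈-Ok (≈trans e f) p = ≈-Ok f (≈-Ok e p)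
≈-Ok ≈comm        (nd p q d) = nd q p λ i j → d j i
≈-Ok ≈assoc       (nd (nd p q d) r e) =
  nd p (nd q r λ i → e (inʳ i)) λ { i (inˡ j) → d i j ; i (inʳ j) → e (inˡ i) j }
≈-Ok (≈cong e f)  (nd p q d) =
  nd (≈-Ok e p) (≈-Ok f q) λ i j → d (≈-∈ (≈sym e) i) (≈-∈ (≈sym f) j)

≈-ev : ∀ β → s ≈ t → ev β s ≡ ev β t
≈-ev β ≈refl        = refl
≈-ev β (≈trans p q) = trans (≈-ev β p) (≈-ev β q)
≈-ev β (≈comm {o})  = op-comm o _ _
≈-ev β (≈assoc {o}) = op-assoc o _ _ _
≈-ev β (≈cong {o = o} p q) = cong₂ (op o) (≈-ev β p) (≈-ev β q)

≈-size : s ≈ t → size s ≡ size t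
≈-size ≈refl        = refl
≈-size (≈trans p q) = trans (≈-size p) (≈-size q)
≈-size (≈comm {s = s}) = ℕₚ.+-comm (size s) _
≈-size (≈assoc {s = s}) = ℕₚ.+-assoc (size s) _ _
≈-size (≈cong p q)  = cong₂ _+_ (≈-size p) (≈-size q)

-- Derivations

-- The unit laws act on the right argument only, as `ac` supplies commutativity. Both directions are
-- listed because a derivation is directed; `absI` may bring in new variables.
data _↝_ : Tree → Tree → Set where
  ac      : s ≈ t → s ↝ t
  unitE   : nd o t (cst o) ↝ t
  unitI   : t ↝ nd o t (cst o)
  absE    : nd o t (cst (not o)) ↝ cst (not o)
  absI    : cst (not o) ↝ nd o t (cst (not o))
  switchᵗ : nd true s (nd false t u) ↝ nd false (nd true s t) u
  medialᵗ : nd false (nd true r s) (nd true t u) ↝ nd true (nd false r t) (nd false s u)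
  congˡ   : s ↝ s′ → nd o s t ↝ nd o s′ t
  congʳ   : t ↝ t′ → nd o s t ↝ nd o s t′

-- All trees along a derivation keep within P, so that derivations with
-- disjoint bounds can be put side by side.
D : (ℕ → Set) → Tree → Tree → Set
D P = Star λ s t → s ↝ t × Ok P s × Ok P t

step : s ↝ t → Ok P s → Ok P t → D P s t
step e p q = (e , p , q) ◅ ε

acD : Ok P s → s ≈ t → D P s t
acD p e = step (ac e) p (≈-Ok e p)

D-target : Ok P s → D P s t → Ok P t
D-target p ε                 = p
D-target p ((_ , _ , q) ◅ d) = D-target q d

D-congˡ : (∀ {x} → R x → P x) → Ok P t → (∀ {x} → R x → x ∈ᵗ t → Empty) →
          D R s s′ → D P (nd o s t) (nd o s′ t)
D-congˡ f q d = Star.gmap (λ s → nd _ s _) λ { (e , p , p′) →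
  congˡ e , nd (Ok-mono f p)  q (λ i → d (Ok-∈ p i))
          , nd (Ok-mono f p′) q (λ i → d (Ok-∈ p′ i)) }

D-congʳ : (∀ {x} → R x → P x) → Ok P s → (∀ {x} → R x → x ∈ᵗ s → Empty) →
          D R t t′ → D P (nd o s t) (nd o s t′)
D-congʳ f q d = Star.gmap (λ t → nd _ _ t) λ { (e , p , p′) →
  congʳ e , nd q (Ok-mono f p)  (λ i j → d (Ok-∈ p j) i)
          , nd q (Ok-mono f p′) (λ i j → d (Ok-∈ p′ j) i) }

D-cong : (∀ {x} → Q x → P x) → (∀ {x} → R x → P x) → (∀ {x} → Q x → R x → Empty) →
         Ok Q s → Ok R t → D Q s s′ → D R t t′ → D P (nd o s t) (nd o s′ t′)
D-cong f g dis p q d e =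
  D-congˡ f (Ok-mono g q) (λ k j → dis k (Ok-∈ q j)) d ◅◅
  D-congʳ g (Ok-mono f p′) (λ k j → dis (Ok-∈ p′ j) k) e
  where p′ = D-target p d

D-cong∈ : Ok P (nd o s t) → D (_∈ᵗ s) s s′ → D (_∈ᵗ t) t t′ → D P (nd o s t) (nd o s′ t′)
D-cong∈ (nd p q d) = D-cong (Ok-∈ p) (Ok-∈ q) d (Ok-self p) (Ok-self q)

D-switch : Ok P (nd true s (nd false t u)) →
           D P (nd true s (nd false t u)) (nd false (nd true s t) u)
D-switch p@(nd p₁ (nd p₂ p₃ d) e) =
  step switchᵗ p (nd (nd p₁ p₂ λ i j → e i (inˡ j)) p₃ λ { (inˡ i) j → e i (inʳ j) ; (inʳ i) j → d i j })

-- Duality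

-- Atoms stay as they are, so the dual of a tree is again a tree over unsigned atoms; it computes
-- the negation under the negated assignment.
dualᵗ : Tree → Tree
dualᵗ (cst b)    = cst (not b)
dualᵗ (at x)     = at x
dualᵗ (nd o s t) = nd (not o) (dualᵗ s) (dualᵗ t)

dualᵗ-involutive : ∀ t → dualᵗ (dualᵗ t) ≡ t
dualᵗ-involutive (cst b) = cong cst (𝔹ₚ.not-involutive b)
dualᵗ-involutive (at x)  = refl
dualᵗ-involutive (nd o s t)
  rewrite 𝔹ₚ.not-involutive o | dualᵗ-involutive s | dualᵗ-involutive t = refl

size-dual : ∀ t → size (dualᵗ t) ≡ size t
size-dual (cst b)    = refl
size-dual (at x)     = refl
size-dual (nd o s t) = cong₂ _+_ (size-dual s) (size-dual t)

dual-∈⁻ : ∀ t → x ∈ᵗ dualᵗ t → x ∈ᵗ t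
dual-∈⁻ (at x)     here    = here
dual-∈⁻ (nd o s t) (inˡ i) = inˡ (dual-∈⁻ s i)
dual-∈⁻ (nd o s t) (inʳ i) = inʳ (dual-∈⁻ t i)

dual-∈ : x ∈ᵗ t → x ∈ᵗ dualᵗ t
dual-∈ here    = here
dual-∈ (inˡ i) = inˡ (dual-∈ i)
dual-∈ (inʳ i) = inʳ (dual-∈ i)

Ok-dual : Ok P t → Ok P (dualᵗ t)
Ok-dual cst    = cst
Ok-dual (at p) = at p
Ok-dual (nd {s = s} {t = t} p q d) =
  nd (Ok-dual p) (Ok-dual q) λ i j → d (dual-∈⁻ s i) (dual-∈⁻ t j)

op-not : ∀ o a b → op (not o) (not a) (not b) ≡ not (op o a b)
op-not true  true  b = refl
op-not true  false b = refl
op-not false true  b = refl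
op-not false false b = refl

ev-dual : ∀ β t → ev β (dualᵗ t) ≡ not (ev (not ∘ β) t)
ev-dual β (cst b)    = refl
ev-dual β (at x)     = sym (𝔹ₚ.not-involutive (β x))
ev-dual β (nd o s t) =
  trans (cong₂ (op (not o)) (ev-dual β s) (ev-dual β t)) (op-not o _ _)

dual-≤ᵗ : s ≤ᵗ t → dualᵗ t ≤ᵗ dualᵗ s
dual-≤ᵗ {s} {t} h β e with ev (not ∘ β) s in es | ev-dual β s | ev-dual β t
... | false | q | r = q
... | true  | q | r rewrite h (not ∘ β) es with trans (sym e) r
... | ()

≈-dual : s ≈ t → dualᵗ s ≈ dualᵗ t
≈-dual ≈refl        = ≈refl
≈-dual (≈trans p q) = ≈trans (≈-dual p) (≈-dual q)
≈-dual ≈comm        = ≈comm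
≈-dual ≈assoc       = ≈assoc
≈-dual (≈cong p q)  = ≈cong (≈-dual p) (≈-dual q)

D-switch′ : Ok P (nd true (nd false s t) u) →
            D P (nd true (nd false s t) u) (nd false s (nd true t u))
D-switch′ {P} {s} {t} {u} p@(nd (nd p₁ p₂ d) p₃ e) =
  acD p (≈trans ≈comm (≈cong ≈refl ≈comm)) ◅◅
  step switchᵗ (≈-Ok (≈trans ≈comm (≈cong ≈refl ≈comm)) p) q ◅◅
  acD q (≈trans ≈comm (≈cong ≈refl ≈comm))
  where
  q : Ok P (nd false (nd true u t) s)
  q = nd (nd p₃ p₂ λ i j → e (inʳ j) i) p₁ λ { (inˡ i) j → e (inˡ j) i ; (inʳ i) j → d j i }

-- Read backwards through duality, a medial is again a medial, and a switch is a switch up to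
-- commutativity.
↝-dual : s ↝ t → Ok P s → Ok P t → D P (dualᵗ t) (dualᵗ s)
↝-dual (ac e)    p q = acD (Ok-dual q) (≈-dual (≈sym e))
↝-dual unitE     p q = step unitI (Ok-dual q) (Ok-dual p)
↝-dual unitI     p q = step unitE (Ok-dual q) (Ok-dual p)
↝-dual absE      p q = step absI (Ok-dual q) (Ok-dual p)
↝-dual absI      p q = step absE (Ok-dual q) (Ok-dual p)
↝-dual switchᵗ   p q = D-switch′ (Ok-dual q)
↝-dual medialᵗ   p q = step medialᵗ (Ok-dual q) (Ok-dual p)
↝-dual (congˡ {s = s} {s′ = s′} {t = t} e) (nd p₁ p₂ d) (nd q₁ q₂ d′) =
  -- The dual of one step may take several, so the inner bound has to cover both ends; each of them
  -- is disjoint from `t`.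
  D-congˡ {R = λ x → x ∈ᵗ s ⊎ x ∈ᵗ s′} [ Ok-∈ p₁ , Ok-∈ q₁ ]′ (Ok-dual p₂)
    (λ k j → [ (λ i → d i (dual-∈⁻ t j)) , (λ i → d′ i (dual-∈⁻ t j)) ]′ k)
    (↝-dual e (Ok-restrict p₁ inj₁) (Ok-restrict q₁ inj₂))
↝-dual (congʳ {t = s} {t′ = s′} {s = t} e) (nd p₁ p₂ d) (nd q₁ q₂ d′) =
  D-congʳ {R = λ x → x ∈ᵗ s ⊎ x ∈ᵗ s′} [ Ok-∈ p₂ , Ok-∈ q₂ ]′ (Ok-dual p₁)
    (λ k j → [ (λ i → d (dual-∈⁻ t j) i) , (λ i → d′ (dual-∈⁻ t j) i) ]′ k)
    (↝-dual e (Ok-restrict p₂ inj₁) (Ok-restrict q₂ inj₂))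

D-dual : D P s t → D P (dualᵗ t) (dualᵗ s)
D-dual ε                 = ε
D-dual ((e , p , q) ◅ d) = D-dual d ◅◅ ↝-dual e p q

D-undual : D P (dualᵗ t) (dualᵗ s) → D P s t
D-undual d = subst₂ (D _) (dualᵗ-involutive _) (dualᵗ-involutive _) (D-dual d)

-- Restriction to a set of variables

absorb : Bool → Bool → Tree → Tree
absorb true  true  t = t
absorb true  false t = cst false
absorb false true  t = cst true
absorb false false t = t

simp : Bool → Tree → Tree → Tree
simp o (cst c)          t          = absorb o c t
simp o s@(at _)         (cst c)    = absorb o c s
simp o s@(nd _ _ _)     (cst c)    = absorb o c s
simp o s                t          = nd o s t

-- A view of the outcomes of `simp`: facts about it then need three cases instead of one for every
-- pair of shapes.
data Simp (o : Bool) : Tree → Tree → Tree → Set where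
  left  : ∀ c t → Simp o (cst c) t (absorb o c t)
  right : ∀ s c → Simp o s (cst c) (absorb o c s)
  keep  : ∀ s t → Simp o s t (nd o s t)

simp-view : ∀ o s t → Simp o s t (simp o s t)
simp-view o (cst c)    t          = left c t
simp-view o (at x)     (cst c)    = right (at x) c
simp-view o (nd _ _ _) (cst c)    = right _ c
simp-view o (at x)     (at y)     = keep _ _
simp-view o (at x)     (nd _ _ _) = keep _ _
simp-view o (nd _ _ _) (at x)     = keep _ _
simp-view o (nd _ _ _) (nd _ _ _) = keep _ _

absorb-∈ : ∀ o c → x ∈ᵗ absorb o c t → x ∈ᵗ t
absorb-∈ true  true  i = i
absorb-∈ false false i = i

simp-∈ : Simp o s t u → x ∈ᵗ u → x ∈ᵗ nd o s t
simp-∈ {o} (left c t)  i = inʳ (absorb-∈ o c i)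
simp-∈ {o} (right s c) i = inˡ (absorb-∈ o c i)
simp-∈     (keep s t)  i = i

absorb-ev : ∀ β o c t → ev β (absorb o c t) ≡ op o c (ev β t)
absorb-ev β true  true  t = refl
absorb-ev β true  false t = refl
absorb-ev β false true  t = refl
absorb-ev β false false t = refl

simp-ev : ∀ β → Simp o s t u → ev β u ≡ op o (ev β s) (ev β t)
simp-ev {o} β (left c t)  = absorb-ev β o c t
simp-ev {o} β (right s c) = trans (absorb-ev β o c s) (op-comm o c _)
simp-ev     β (keep s t)  = refl

absorb-size : ∀ o c t → size (absorb o c t) ≤ size t
absorb-size true  true  t = ℕₚ.≤-refl
absorb-size true  false t = z≤n
absorb-size false true  t = z≤n
absorb-size false false t = ℕₚ.≤-refl

simp-size : Simp o s t u → size u ≤ size s + size t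
simp-size {o} (left c t)  = absorb-size o c t
simp-size {o} (right s c) = ℕₚ.≤-trans (absorb-size o c s) (ℕₚ.m≤m+n _ _)
simp-size     (keep s t)  = ℕₚ.≤-refl

absorb-D : ∀ o c → Ok P t → D P (nd o t (cst c)) (absorb o c t) × D P (absorb o c t) (nd o t (cst c))
absorb-D true  true  p = step unitE (nd p cst λ _ ()) p , step unitI p (nd p cst λ _ ())
absorb-D true  false p = step absE (nd p cst λ _ ()) cst , step absI cst (nd p cst λ _ ())
absorb-D false true  p = step absE (nd p cst λ _ ()) cst , step absI cst (nd p cst λ _ ())
absorb-D false false p = step unitE (nd p cst λ _ ()) p , step unitI p (nd p cst λ _ ())

simp-D : Simp o s t u → Ok P (nd o s t) → D P (nd o s t) u × D P u (nd o s t)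
simp-D {o} (left c t) p@(nd p₁ p₂ _) =
  acD p ≈comm ◅◅ proj₁ (absorb-D o c p₂) ,
  proj₂ (absorb-D o c p₂) ◅◅ acD (≈-Ok ≈comm p) ≈comm
simp-D {o} (right s c) (nd p₁ p₂ _) = absorb-D o c p₁
simp-D     (keep s t)  p = ε , ε

dual-absorb : ∀ o c t → dualᵗ (absorb o c t) ≡ absorb (not o) (not c) (dualᵗ t)
dual-absorb true  true  t = refl
dual-absorb true  false t = refl
dual-absorb false true  t = refl
dual-absorb false false t = refl

dual-simp : ∀ o s t → dualᵗ (simp o s t) ≡ simp (not o) (dualᵗ s) (dualᵗ t)
dual-simp o (cst c)    t          = dual-absorb o c t
dual-simp o (at x)     (cst c)    = dual-absorb o c (at x)
dual-simp o s@(nd _ _ _) (cst c)  = dual-absorb o c s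
dual-simp o (at x)     (at y)     = refl
dual-simp o (at x)     (nd _ _ _) = refl
dual-simp o (nd _ _ _) (at x)     = refl
dual-simp o (nd _ _ _) (nd _ _ _) = refl

-- restr K b t is t with b for the variables outside K, freed of constants.
restr : (ℕ → Bool) → Bool → Tree → Tree
restr K b (cst c)    = cst c
restr K b (at x)     = if K x then at x else cst b
restr K b (nd o s t) = simp o (restr K b s) (restr K b t)

restr-∈ : ∀ {K} t → x ∈ᵗ restr K b t → x ∈ᵗ t × K x ≡ true
restr-∈ {K = K} (at y) i with K y in e
restr-∈ {K = K} (at y) here | true = here , e
restr-∈ {b = b} {K} (nd o s t) i with simp-∈ (simp-view o (restr K b s) (restr K b t)) i
... | inˡ j = inˡ (proj₁ (restr-∈ s j)) , proj₂ (restr-∈ s j)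
... | inʳ j = inʳ (proj₁ (restr-∈ t j)) , proj₂ (restr-∈ t j)

simp-Ok : Simp o s t u → Ok P (nd o s t) → Ok P u
simp-Ok v p = D-target p (proj₁ (simp-D v p))

restr-Ok : ∀ {K} → Ok P t → Ok P (restr K b t)
restr-Ok cst = cst
restr-Ok {K = K} (at {x} p) with K x
... | true  = at p
... | false = cst
restr-Ok {b = b} {K} (nd {s = s} {t = t} p q d) =
  simp-Ok (simp-view _ _ _) (nd (restr-Ok p) (restr-Ok q) λ i j → d (proj₁ (restr-∈ s i)) (proj₁ (restr-∈ t j)))

restr-Ok-K : ∀ {K} → Ok P t → Ok (λ x → P x × K x ≡ true) (restr K b t)
restr-Ok-K {t = t} p = Ok-restrict (restr-Ok p) λ i → Ok-∈ p (proj₁ (restr-∈ t i)) , proj₂ (restr-∈ t i)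

restr-ev : ∀ β K b t → ev β (restr K b t) ≡ ev (λ x → if K x then β x else b) t
restr-ev β K b (cst c) = refl
restr-ev β K b (at x) with K x
... | true  = refl
... | false = refl
restr-ev β K b (nd o s t) =
  trans (simp-ev β (simp-view o (restr K b s) (restr K b t))) (cong₂ (op o) (restr-ev β K b s) (restr-ev β K b t))

restr-size : ∀ K b t → size (restr K b t) ≤ size t
restr-size K b (cst c) = z≤n
restr-size K b (at x) with K x
... | true  = ℕₚ.≤-refl
... | false = z≤n
restr-size K b (nd o s t) =
  ℕₚ.≤-trans (simp-size (simp-view o (restr K b s) (restr K b t))) (ℕₚ.+-mono-≤ (restr-size K b s) (restr-size K b t))

restr-size< : ∀ K b → x ∈ᵗ t → K x ≡ false → size (restr K b t) < size t
restr-size< K b here e rewrite e = s≤s z≤n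
restr-size< K b (inˡ {s = s} {t = t} i) e =
  ℕₚ.≤-<-trans (simp-size (simp-view _ (restr K b s) (restr K b t))) (ℕₚ.+-mono-<-≤ (restr-size< K b i e) (restr-size K b t))
restr-size< K b (inʳ {t = t} {s = s} i) e =
  ℕₚ.≤-<-trans (simp-size (simp-view _ (restr K b s) (restr K b t))) (ℕₚ.+-mono-≤-< (restr-size K b s) (restr-size< K b i e))

dual-restr : ∀ K b t → dualᵗ (restr K b t) ≡ restr K (not b) (dualᵗ t)
dual-restr K b (cst c) = refl
dual-restr K b (at x) with K x
... | true  = refl
... | false = refl
dual-restr K b (nd o s t) =
  trans (dual-simp o (restr K b s) (restr K b t)) (cong₂ (simp (not o)) (dual-restr K b s) (dual-restr K b t))

data ConstFree : Tree → Set where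
  at : ConstFree (at x)
  nd : ConstFree s → ConstFree t → ConstFree (nd o s t)

data Normal : Tree → Set where
  const : ∀ c → Normal (cst c)
  free  : ConstFree t → Normal t

absorb-Normal : ∀ o c → Normal t → Normal (absorb o c t)
absorb-Normal true  true  n = n
absorb-Normal true  false n = const _
absorb-Normal false true  n = const _
absorb-Normal false false n = n

simp-Normal : ∀ o → Normal s → Normal t → Normal (simp o s t)
simp-Normal o (const c) n = absorb-Normal o c n
simp-Normal o (free f@at)       (const c) = absorb-Normal o c (free f)
simp-Normal o (free f@(nd _ _)) (const c) = absorb-Normal o c (free f)
simp-Normal o (free f@at)       (free g@at) = free (nd f g)
simp-Normal o (free f@at)       (free g@(nd _ _)) = free (nd f g)
simp-Normal o (free f@(nd _ _)) (free g@at) = free (nd f g)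
simp-Normal o (free f@(nd _ _)) (free g@(nd _ _)) = free (nd f g)

restr-Normal : ∀ K b t → Normal (restr K b t)
restr-Normal K b (cst c) = const c
restr-Normal K b (at x) with K x
... | true  = free at
... | false = const b
restr-Normal K b (nd o s t) = simp-Normal o (restr-Normal K b s) (restr-Normal K b t)

-- Derived rules

-- One switch suffices: `t ∧ ⊤`, written as `t ∧ (⊥ ∨ ⊤)`, becomes `(t ∧ ⊥) ∨ ⊤`, which is absorbed
-- into `⊤`.
weaken : Ok P t → D P t (cst true)
weaken p =
  step unitI p q ◅◅
  step (congʳ (absI {o = false} {t = cst false})) q (nd p (nd cst cst λ ()) λ { _ (inˡ ()) ; _ (inʳ ()) }) ◅◅
  step switchᵗ (nd p (nd cst cst λ ()) λ { _ (inˡ ()) ; _ (inʳ ()) })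
               (nd (nd p cst λ _ ()) cst λ _ ()) ◅◅
  step absE (nd (nd p cst λ _ ()) cst λ _ ()) cst
  where q = nd p cst λ _ ()

exFalso : Ok P t → D P (cst false) t
exFalso p = D-undual (weaken (Ok-dual p))

restr-up : ∀ K t → Ok P t → D P t (restr K true t)
restr-up K (cst c) p = ε
restr-up K (at x)  p with K x
... | true  = ε
... | false = weaken p
restr-up K (nd o s t) p@(nd p₁ p₂ d) = d₁ ◅◅ proj₁ (simp-D (simp-view _ _ _) (D-target p d₁))
  where d₁ = D-cong∈ p (restr-up K s (Ok-self p₁)) (restr-up K t (Ok-self p₂))

restr-down : ∀ K t → Ok P t → D P (restr K false t) t
restr-down K t p =
  D-undual (subst (D _ (dualᵗ t)) (sym (dual-restr K false t)) (restr-up K (dualᵗ t) (Ok-dual p)))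

-- No atom has been replaced, so the restriction has only simplified the constants of `t`, and the
-- unit laws run backwards restore them.
unrestr : ∀ K b t → Ok P t → (∀ {x} → x ∈ᵗ t → K x ≡ true) → D P (restr K b t) t
unrestr K b (cst c) p f = ε
unrestr K b (at x)  p f rewrite f here = ε
unrestr K b (nd o s t) p@(nd p₁ p₂ d) f =
  proj₂ (simp-D (simp-view _ _ _) q) ◅◅
  D-cong (λ i → Ok-∈ p₁ i) (Ok-∈ p₂) d
    (restr-Ok (Ok-self p₁)) (restr-Ok (Ok-self p₂))
    (unrestr K b s (Ok-self p₁) (f ∘ inˡ)) (unrestr K b t (Ok-self p₂) (f ∘ inʳ))
  where q = nd (restr-Ok p₁) (restr-Ok p₂) λ i j → d (proj₁ (restr-∈ s i)) (proj₁ (restr-∈ t j))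

-- Each atom splits off a `⊤` on one side. At a node the two conjunctions below are regrouped by
-- associativity and commutativity under ∧, and by a medial under ∨.
project : ∀ K t → Ok P t → D P t (nd true (restr K true t) (restr (not ∘ K) true t))
project K (cst true)  p = step unitI p (nd p p λ ())
project K (cst false) p = step absI p (nd p p λ ())
project K (at x)      p with K x
... | true  = step unitI p (nd p cst λ _ ())
... | false = step unitI p (nd p cst λ _ ()) ◅◅ acD (nd p cst λ _ ()) ≈comm
project {P} K (nd o s t) p@(nd p₁ p₂ d) = d₁ ◅◅ exchange o q₁ ◅◅
  D-cong∈ (D-target q₁ (exchange o q₁))
    (proj₁ (simp-D (simp-view o _ _) (Ok-self (Okˡ q₂))))
    (proj₁ (simp-D (simp-view o _ _) (Ok-self (Okʳ q₂))))
  where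
  d₁ = D-cong∈ {o = o} p (project K s (Ok-self p₁)) (project K t (Ok-self p₂))
  q₁ = D-target p d₁
  exchange : ∀ o {r s t u} → Ok P (nd o (nd true r s) (nd true t u)) →
             D P (nd o (nd true r s) (nd true t u)) (nd true (nd o r t) (nd o s u))
  exchange true  q = acD q ≈interchange
  exchange false q@(nd (nd a b d₁) (nd c e d₂) f) = step medialᵗ q
    (nd (nd a c λ i j → f (inˡ i) (inˡ j)) (nd b e λ i j → f (inʳ i) (inʳ j))
        λ { (inˡ i) (inˡ j) → d₁ i j ; (inˡ i) (inʳ j) → f (inˡ i) (inʳ j)
          ; (inʳ i) (inˡ j) → f (inʳ j) (inˡ i) ; (inʳ i) (inʳ j) → d₂ i j })
  q₂ = D-target q₁ (exchange o q₁)

≢ᵇ : ℕ → ℕ → Bool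
≢ᵇ x y = not (does (x ≟ y))

≢ᵇ-true : x ≢ y → ≢ᵇ x y ≡ true
≢ᵇ-true {x} {y} n = cong not (dec-false (x ≟ y) n)

≢ᵇ-refl : ∀ x → ≢ᵇ x x ≡ false
≢ᵇ-refl x = cong not (dec-true (x ≟ x) refl)

module _ {x : ℕ} (o : Bool) {s t : Tree} where

  private
    s₁ t₁ : Tree
    s₁ = restr (≢ᵇ x) true s
    t₁ = restr (≢ᵇ x) true t

  restr-fresh : ∀ u → y ∈ᵗ at x → y ∈ᵗ restr (≢ᵇ x) b u → Empty
  restr-fresh u here j with trans (sym (≢ᵇ-refl x)) (proj₂ (restr-∈ u j))
  ... | ()

  pinned-Ok : x ∈ᵗ nd o s t → Ok P (nd o s t) → Ok P (nd true (at x) (nd o s₁ t₁))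
  pinned-Ok i p@(nd p₁ p₂ d) =
    nd (at (Ok-∈ p i))
       (nd (restr-Ok p₁) (restr-Ok p₂) λ j k → d (proj₁ (restr-∈ s j)) (proj₁ (restr-∈ t k)))
       λ { j (inˡ k) → restr-fresh s j k ; j (inʳ k) → restr-fresh t j k }

  pinned-unsimp : x ∈ᵗ nd o s t → Ok P (nd o s t) →
                  D P (nd true (at x) (simp o s₁ t₁)) (nd true (at x) (nd o s₁ t₁))
  pinned-unsimp i p with pinned-Ok i p
  ... | nd q₁ q₂ d =
    D-congʳ (Ok-∈ q₂) q₁ (λ k j → d j k) (proj₂ (simp-D (simp-view o s₁ t₁) (Ok-self q₂)))

  -- As `x` lies in `s`, linearity keeps it out of `t`, so the restriction of `t` can be undone by
  -- `unrestr`.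
  deepSwitch-node : x ∈ᵗ s → Ok P (nd o s t) → D (_∈ᵗ s) (nd true (at x) s₁) s →
                    D P (nd true (at x) (nd o s₁ t₁)) (nd o s t)
  deepSwitch-node {P} i p@(nd p₁ p₂ d) ih =
    move o (pinned-Ok (inˡ i) p) ◅◅
    D-cong (Ok-∈ p₁) (Ok-∈ p₂) d
      (nd (at i) (restr-Ok (Ok-self p₁)) (restr-fresh s)) (restr-Ok (Ok-self p₂)) ih
      (unrestr (≢ᵇ x) true t (Ok-self p₂) λ {y} j → ≢ᵇ-true {x} {y} λ { refl → d i j })
    where
    move : ∀ o {r s t} → Ok P (nd true r (nd o s t)) → D P (nd true r (nd o s t)) (nd o (nd true r s) t)
    move true  q = acD q ≈assoc⁻
    move false q = D-switch q

-- x ∧ ψ[x := ⊤] → ψ: push x down to its place, by switch at every ∨ on the way.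
deepSwitch : x ∈ᵗ t → Ok P t → D P (nd true (at x) (restr (≢ᵇ x) true t)) t
deepSwitch {x} here (at p) rewrite ≢ᵇ-refl x = step unitE (nd (at p) cst λ _ ()) (at p)
deepSwitch (inˡ {o = o} i) p@(nd p₁ _ _) =
  pinned-unsimp o (inˡ i) p ◅◅ deepSwitch-node o i p (deepSwitch i (Ok-self p₁))
deepSwitch (inʳ {o = o} i) p@(nd _ p₂ _) =
  pinned-unsimp o (inʳ i) p ◅◅
  acD (pinned-Ok o (inʳ i) p) (≈cong ≈refl ≈comm) ◅◅
  deepSwitch-node o i (≈-Ok ≈comm p) (deepSwitch i (Ok-self p₂)) ◅◅
  acD (≈-Ok ≈comm p) ≈comm

-- From trees to formulae

con : Bool → Formula → Formula → Formula
con true  = _∧_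
con false = _∨_

lit : Bool → ℕ → Formula
lit true  = var
lit false = neg

-- The atom x stands for the literal on x with sign σ x.
⟦_⟧ : Tree → (ℕ → Bool) → Formula
⟦ cst true  ⟧ σ = ⊤
⟦ cst false ⟧ σ = ⊥
⟦ at x ⟧      σ = lit (σ x) x
⟦ nd o s t ⟧  σ = con o (⟦ s ⟧ σ) (⟦ t ⟧ σ)

vars : Tree → List ℕ
vars (cst b)    = []
vars (at x)     = [ x ]
vars (nd o s t) = vars s ++ vars t

∈-vars : x ∈ᵗ t → x ∈ vars t
∈-vars here            = Any.here refl
∈-vars (inˡ i)         = ∈ₚ.∈-++⁺ˡ (∈-vars i)
∈-vars (inʳ {s = s} i) = ∈ₚ.∈-++⁺ʳ (vars s) (∈-vars i)

∈-vars⁻ : ∀ t → x ∈ vars t → x ∈ᵗ t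
∈-vars⁻ (at x) (Any.here refl) = here
∈-vars⁻ (nd o s t) i with ∈ₚ.∈-++⁻ (vars s) i
... | inj₁ j = inˡ (∈-vars⁻ s j)
... | inj₂ j = inʳ (∈-vars⁻ t j)

module _ (σ : ℕ → Bool) where

  ⟦⟧-on : Ok P t → ⟦ t ⟧ σ LinearOn vars t
  ⟦⟧-on (cst {true})  = ⊤-on
  ⟦⟧-on (cst {false}) = ⊥-on
  ⟦⟧-on (at {x} _) with σ x
  ... | true  = var-on x
  ... | false = neg-on x
  ⟦⟧-on (nd {s = s} {t = t} {o = true}  p q d) =
    ∧-on (⟦⟧-on p) (⟦⟧-on q) (λ (i , j) → d (∈-vars⁻ s i) (∈-vars⁻ t j)) ↭-refl
  ⟦⟧-on (nd {s = s} {t = t} {o = false} p q d) =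
    ∨-on (⟦⟧-on p) (⟦⟧-on q) (λ (i , j) → d (∈-vars⁻ s i) (∈-vars⁻ t j)) ↭-refl

  ⟦⟧-linear : Ok P t → Linear (⟦ t ⟧ σ)
  ⟦⟧-linear p = _ , ⟦⟧-on p

  con-congˡ : ∀ {T} o → Ok P (nd o s t) → Ok P (nd o s′ t) →
              Congruence T (⟦ s ⟧ σ) (⟦ s′ ⟧ σ) → Congruence T (⟦ nd o s t ⟧ σ) (⟦ nd o s′ t ⟧ σ)
  con-congˡ true  p q = ∧-congˡ (⟦⟧-linear p) (⟦⟧-linear q)
  con-congˡ false p q = ∨-congˡ (⟦⟧-linear p) (⟦⟧-linear q)

  con-congʳ : ∀ {T} o → Ok P (nd o s t) → Ok P (nd o s t′) →
              Congruence T (⟦ t ⟧ σ) (⟦ t′ ⟧ σ) → Congruence T (⟦ nd o s t ⟧ σ) (⟦ nd o s t′ ⟧ σ)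
  con-congʳ true  p q = ∧-congʳ (⟦⟧-linear p) (⟦⟧-linear q)
  con-congʳ false p q = ∨-congʳ (⟦⟧-linear p) (⟦⟧-linear q)

  ≈⇒∼ac : s ≈ t → Ok P s → ⟦ s ⟧ σ ∼ac ⟦ t ⟧ σ
  ≈⇒∼ac ≈refl          p = reflex (⟦⟧-linear p)
  ≈⇒∼ac (≈trans e f)   p = transit (≈⇒∼ac e p) (≈⇒∼ac f (≈-Ok e p))
  ≈⇒∼ac (≈comm {true})  p = base (⟦⟧-linear p) (⟦⟧-linear (≈-Ok ≈comm p)) (∧-comm _ _)
  ≈⇒∼ac (≈comm {false}) p = base (⟦⟧-linear p) (⟦⟧-linear (≈-Ok ≈comm p)) (∨-comm _ _)
  ≈⇒∼ac (≈assoc {true})  p = base (⟦⟧-linear p) (⟦⟧-linear (≈-Ok ≈assoc p)) (∧-assoc _ _ _)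
  ≈⇒∼ac (≈assoc {false}) p = base (⟦⟧-linear p) (⟦⟧-linear (≈-Ok ≈assoc p)) (∨-assoc _ _ _)
  ≈⇒∼ac (≈cong {o = o} e f) p@(nd p₁ p₂ _) =
    transit (con-congˡ o p q (≈⇒∼ac e p₁)) (con-congʳ o q (≈-Ok (≈cong ≈refl f) q) (≈⇒∼ac f p₂))
    where q = ≈-Ok (≈cong e ≈refl) p

  units : Ok P s → Ok P t → UnitAxiom (⟦ s ⟧ σ) (⟦ t ⟧ σ) → ⟦ s ⟧ σ ∼acu ⟦ t ⟧ σ
  units p q a = base (⟦⟧-linear p) (⟦⟧-linear q) (inj₂ (base (⟦⟧-linear p) (⟦⟧-linear q) a))

  unit-acu : ∀ o → Ok P (nd o t (cst o)) → Ok P t → ⟦ nd o t (cst o) ⟧ σ ∼acu ⟦ t ⟧ σ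
  unit-acu true  p q = units p q (∧-⊤ʳ _)
  unit-acu false p q = units p q (∨-⊥ʳ _)

  absorb-acu : ∀ o → Ok P (nd o t (cst (not o))) → ⟦ nd o t (cst (not o)) ⟧ σ ∼acu ⟦ cst (not o) ⟧ σ
  absorb-acu true  p = units {t = cst false} p cst (∧-⊥ʳ _)
  absorb-acu false p = units {t = cst true} p cst (∨-⊤ʳ _)

  instance-switch : Ok P (nd true s (nd false t u)) → Ok P (nd false (nd true s t) u) →
    Step SwitchMedial (⟦ nd true s (nd false t u) ⟧ σ) (⟦ nd false (nd true s t) u ⟧ σ)
  instance-switch {s = s} {t} {u} p@(nd a (nd b c _) _) q =
    inst θ θ-linear (⟦⟧-linear p) (⟦⟧-linear q) (rule (switchMedial-isLinearInference switch) switch)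
    where
    θ : ℕ → Formula
    θ 1 = ⟦ s ⟧ σ
    θ 2 = ⟦ t ⟧ σ
    θ 3 = ⟦ u ⟧ σ
    θ _ = ⊤
    θ-linear : ∀ x → Linear (θ x)
    θ-linear 0 = _ , ⊤-on
    θ-linear 1 = ⟦⟧-linear a
    θ-linear 2 = ⟦⟧-linear b
    θ-linear 3 = ⟦⟧-linear c
    θ-linear (suc (suc (suc (suc _)))) = _ , ⊤-on

  instance-medial : Ok P (nd false (nd true r s) (nd true t u)) → Ok P (nd true (nd false r t) (nd false s u)) →
    Step SwitchMedial (⟦ nd false (nd true r s) (nd true t u) ⟧ σ) (⟦ nd true (nd false r t) (nd false s u) ⟧ σ)
  instance-medial {r = r} {s} {t} {u} p@(nd (nd a b _) (nd c d _) _) q =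
    inst θ θ-linear (⟦⟧-linear p) (⟦⟧-linear q) (rule (switchMedial-isLinearInference medial) medial)
    where
    θ : ℕ → Formula
    θ 0 = ⟦ r ⟧ σ
    θ 1 = ⟦ s ⟧ σ
    θ 2 = ⟦ t ⟧ σ
    θ 3 = ⟦ u ⟧ σ
    θ _ = ⊤
    θ-linear : ∀ x → Linear (θ x)
    θ-linear 0 = ⟦⟧-linear a
    θ-linear 1 = ⟦⟧-linear b
    θ-linear 2 = ⟦⟧-linear c
    θ-linear 3 = ⟦⟧-linear d
    θ-linear (suc (suc (suc (suc _)))) = _ , ⊤-on

  ↝-step : s ↝ t → Ok P s → Ok P t →
           Step SwitchMedial (⟦ s ⟧ σ) (⟦ t ⟧ σ) ⊎ ⟦ s ⟧ σ ∼acu ⟦ t ⟧ σ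
  ↝-step (ac e) p q =
    inj₂ (base (⟦⟧-linear p) (⟦⟧-linear q) (inj₁ (≈⇒∼ac e p)))
  ↝-step unitE p q = inj₂ (unit-acu _ p q)
  ↝-step unitI p q = inj₂ (symm (unit-acu _ q p))
  ↝-step absE  p q = inj₂ (absorb-acu _ p)
  ↝-step absI  p q = inj₂ (symm (absorb-acu _ q))
  ↝-step switchᵗ p q = inj₁ (instance-switch p q)
  ↝-step medialᵗ p q = inj₁ (instance-medial p q)
  ↝-step (congˡ {o = true} e) p@(nd p₁ _ _) q@(nd q₁ _ _) with ↝-step e p₁ q₁
  ... | inj₁ a = inj₁ (∧-ctxˡ (⟦⟧-linear p) (⟦⟧-linear q) a)
  ... | inj₂ a = inj₂ (con-congˡ true p q a)
  ↝-step (congˡ {o = false} e) p@(nd p₁ _ _) q@(nd q₁ _ _) with ↝-step e p₁ q₁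
  ... | inj₁ a = inj₁ (∨-ctxˡ (⟦⟧-linear p) (⟦⟧-linear q) a)
  ... | inj₂ a = inj₂ (con-congˡ false p q a)
  ↝-step (congʳ {o = true} e) p@(nd _ p₁ _) q@(nd _ q₁ _) with ↝-step e p₁ q₁
  ... | inj₁ a = inj₁ (∧-ctxʳ (⟦⟧-linear p) (⟦⟧-linear q) a)
  ... | inj₂ a = inj₂ (con-congʳ true p q a)
  ↝-step (congʳ {o = false} e) p@(nd _ p₁ _) q@(nd _ q₁ _) with ↝-step e p₁ q₁
  ... | inj₁ a = inj₁ (∨-ctxʳ (⟦⟧-linear p) (⟦⟧-linear q) a)
  ... | inj₂ a = inj₂ (con-congʳ false p q a)

  D⇒derivable : D P s t → DerivableWithUnits SwitchMedial (⟦ s ⟧ σ) (⟦ t ⟧ σ)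
  D⇒derivable = Star.gmap (λ t → ⟦ t ⟧ σ) λ { (e , p , q) → wrap p q (↝-step e p q) }
    where
    wrap : Ok P s → Ok P t → Step SwitchMedial (⟦ s ⟧ σ) (⟦ t ⟧ σ) ⊎ ⟦ s ⟧ σ ∼acu ⟦ t ⟧ σ →
           StepU SwitchMedial (⟦ s ⟧ σ) (⟦ t ⟧ σ) ⊎ ⟦ s ⟧ σ ∼acu ⟦ t ⟧ σ
    wrap p q (inj₁ a) = inj₁ (_ , _ , reflex (⟦⟧-linear p) , a , reflex (⟦⟧-linear q))
    wrap p q (inj₂ a) = inj₂ a

-- From formulae to trees

tree : Formula → Tree
tree ⊤       = cst true
tree ⊥       = cst false
tree (var x) = at x
tree (neg x) = at x
tree (φ ∧ ψ) = nd true (tree φ) (tree ψ)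
tree (φ ∨ ψ) = nd false (tree φ) (tree ψ)

tree-∈ : ∀ {φ V} → φ LinearOn V → x ∈ᵗ tree φ → x ∈ V
tree-∈ (var-on x) here = Any.here refl
tree-∈ (neg-on x) here = Any.here refl
tree-∈ (∧-on {U = U} p q d w) (inˡ i) = ↭ₚ.∈-resp-↭ (↭-sym w) (∈ₚ.∈-++⁺ˡ (tree-∈ p i))
tree-∈ (∧-on {U = U} p q d w) (inʳ i) = ↭ₚ.∈-resp-↭ (↭-sym w) (∈ₚ.∈-++⁺ʳ U (tree-∈ q i))
tree-∈ (∨-on {U = U} p q d w) (inˡ i) = ↭ₚ.∈-resp-↭ (↭-sym w) (∈ₚ.∈-++⁺ˡ (tree-∈ p i))
tree-∈ (∨-on {U = U} p q d w) (inʳ i) = ↭ₚ.∈-resp-↭ (↭-sym w) (∈ₚ.∈-++⁺ʳ U (tree-∈ q i))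

tree-Ok : ∀ {φ V} → φ LinearOn V → Ok (_∈ᵗ tree φ) (tree φ)
tree-Ok ⊤-on       = cst
tree-Ok ⊥-on       = cst
tree-Ok (var-on x) = at here
tree-Ok (neg-on x) = at here
tree-Ok (∧-on p q d w) =
  nd (Ok-mono inˡ (tree-Ok p)) (Ok-mono inʳ (tree-Ok q)) λ i j → d (tree-∈ p i , tree-∈ q j)
tree-Ok (∨-on p q d w) =
  nd (Ok-mono inˡ (tree-Ok p)) (Ok-mono inʳ (tree-Ok q)) λ i j → d (tree-∈ p i , tree-∈ q j)

⟦⟧-cong : ∀ {σ τ} t → (∀ {x} → x ∈ᵗ t → σ x ≡ τ x) → ⟦ t ⟧ σ ≡ ⟦ t ⟧ τ
⟦⟧-cong (cst true)  f = refl
⟦⟧-cong (cst false) f = refl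
⟦⟧-cong (at x)      f = cong (λ b → lit b x) (f here)
⟦⟧-cong (nd o s t)  f = cong₂ (con o) (⟦⟧-cong s (f ∘ inˡ)) (⟦⟧-cong t (f ∘ inʳ))

-- A variable occurs at most once in a linear formula and so has one sign. At a node the sign
-- functions of the arguments are merged by membership in the left one.
signs : ∀ {φ V} → φ LinearOn V → ∃ λ σ → ⟦ tree φ ⟧ σ ≡ φ
signs-nd : ∀ o {s t φ ψ} → (∀ {x} → x ∈ᵗ s → x ∈ᵗ t → Empty) →
  (∃ λ σ → ⟦ s ⟧ σ ≡ φ) → (∃ λ σ → ⟦ t ⟧ σ ≡ ψ) → ∃ λ σ → ⟦ nd o s t ⟧ σ ≡ con o φ ψ
signs-nd o {s} {t} d (σ , refl) (τ , refl) = υ , cong₂ (con o) (⟦⟧-cong s onˢ) (⟦⟧-cong t onᵗ)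
  where
  υ : ℕ → Bool
  υ x = if does (x ∈ᵗ? s) then σ x else τ x
  onˢ : x ∈ᵗ s → υ x ≡ σ x
  onˢ {x} i rewrite dec-true (x ∈ᵗ? s) i = refl
  onᵗ : x ∈ᵗ t → υ x ≡ τ x
  onᵗ {x} i rewrite dec-false (x ∈ᵗ? s) (λ j → d j i) = refl
signs ⊤-on       = (λ _ → true) , refl
signs ⊥-on       = (λ _ → true) , refl
signs (var-on x) = (λ _ → true) , refl
signs (neg-on x) = (λ _ → false) , refl
signs (∧-on p q d w) = signs-nd true (λ i j → d (tree-∈ p i , tree-∈ q j)) (signs p) (signs q)
signs (∨-on p q d w) = signs-nd false (λ i j → d (tree-∈ p i , tree-∈ q j)) (signs p) (signs q)

signed : Bool → Bool → Bool
signed true  b = b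
signed false b = not b

⟦⟧-eval : ∀ α σ t → eval α (⟦ t ⟧ σ) ≡ ev (λ x → signed (σ x) (α x)) t
⟦⟧-eval α σ (cst true)  = refl
⟦⟧-eval α σ (cst false) = refl
⟦⟧-eval α σ (at x) with σ x
... | true  = refl
... | false = refl
⟦⟧-eval α σ (nd true s t)  = cong₂ _&&_ (⟦⟧-eval α σ s) (⟦⟧-eval α σ t)
⟦⟧-eval α σ (nd false s t) = cong₂ _||_ (⟦⟧-eval α σ s) (⟦⟧-eval α σ t)

length-split : ∀ {A : Set} {p} {P : A → Set p} (P? : ∀ x → Dec (P x)) xs →
               length (filter P? xs) + length (filter (¬? ∘ P?) xs) ≡ length xs
length-split P? [] = refl
length-split P? (x ∷ xs) with P? x
... | yes _ = cong suc (length-split P? xs)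
... | no  _ = trans (ℕₚ.+-suc _ _) (cong suc (length-split P? xs))

-- At a node `ys` is divided by membership in the left argument; linearity sends the right argument
-- to the complement.
size-bound : ∀ ys → Ok (_∈ ys) t → size t ≤ length ys
size-bound ys       cst    = z≤n
size-bound (_ ∷ ys) (at i) = s≤s z≤n
size-bound ys (nd {s = s} p q d) =
  ℕₚ.≤-trans
    (ℕₚ.+-mono-≤
      (size-bound _ (Ok-restrict p λ i → ∈ₚ.∈-filter⁺ (_∈ᵗ? s) (Ok-∈ p i) i))
      (size-bound _ (Ok-restrict q λ i → ∈ₚ.∈-filter⁺ (¬? ∘ (_∈ᵗ? s)) (Ok-∈ q i) λ j → d j i)))
    (ℕₚ.≤-reflexive (length-split (_∈ᵗ? s) ys))

-- The induction

-- The moves that work on the left side; applied to the duals they work on the right. In `drop` a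
-- conjunct already suffices and the rest is weakened away; `split` is the switch.
data Half (φ ψ : Tree) : Set where
  literal : ∀ x r → φ ≈ nd true (at x) r → Half φ ψ
  drop    : ∀ c r → φ ≈ nd true c r → c ≤ᵗ ψ → Half φ ψ
  split   : ∀ r p q → φ ≈ nd true r (nd false p q) → q ≤ᵗ ψ → Half φ ψ

record Goal (P : ℕ → Set) (φ ψ : Tree) : Set where
  constructor goal
  field
    φ-Ok    : Ok P φ
    ψ-Ok    : Ok P ψ
    φ-small : size φ ≤ 7
    ψ-small : size ψ ≤ 7
    entails : φ ≤ᵗ ψ

  weight : ℕ
  weight = size φ + size ψ

open Goal

-- The search knows only enumerated trees on `0, 1, …`. Renamed variables need not satisfy `P`,
-- hence a bound of their own; `transfer` takes a derivation back.
record Canonical (P : ℕ → Set) (φ ψ : Tree) : Set₁ where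
  field
    {bound}     : ℕ → Set
    {φ′ ψ′}     : Tree
    canonical   : Goal bound φ′ ψ′
    same-weight : weight canonical ≡ size φ + size ψ
    φ-free      : ConstFree φ′
    ψ-free      : ConstFree ψ′
    φ⊆ψ         : ∀ {x} → x ∈ᵗ φ′ → x ∈ᵗ ψ′
    ψ⊆φ         : ∀ {x} → x ∈ᵗ ψ′ → x ∈ᵗ φ′
    half        : Half φ′ ψ′ ⊎ Half (dualᵗ ψ′) (dualᵗ φ′)
    transfer    : D bound φ′ ψ′ → D P φ ψ

≈-ConstFree : s ≈ t → ConstFree s → ConstFree t
≈-ConstFree ≈refl        f = f
≈-ConstFree (≈trans e g) f = ≈-ConstFree g (≈-ConstFree e f)
≈-ConstFree ≈comm        (nd f g) = nd g f
≈-ConstFree ≈assoc       (nd (nd f g) h) = nd f (nd g h)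
≈-ConstFree (≈cong d e)  (nd f g) = nd (≈-ConstFree d f) (≈-ConstFree e g)

ConstFree-dual : ConstFree t → ConstFree (dualᵗ t)
ConstFree-dual at       = at
ConstFree-dual (nd f g) = nd (ConstFree-dual f) (ConstFree-dual g)

member : ConstFree t → ∃ λ x → x ∈ᵗ t
member at       = _ , here
member (nd f _) = _ , inˡ (proj₂ (member f))

size>0 : ConstFree t → 0 < size t
size>0 at       = s≤s z≤n
size>0 (nd f _) = ℕₚ.≤-trans (size>0 f) (ℕₚ.m≤m+n _ _)

ev-const : ∀ b → ConstFree t → ev (λ _ → b) t ≡ b
ev-const b at = refl
ev-const true  (nd {o = true}  f g) = cong₂ _&&_ (ev-const true f) (ev-const true g)
ev-const true  (nd {o = false} f g) = cong₂ _||_ (ev-const true f) (ev-const true g)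
ev-const false (nd {o = true}  f g) = cong₂ _&&_ (ev-const false f) (ev-const false g)
ev-const false (nd {o = false} f g) = cong₂ _||_ (ev-const false f) (ev-const false g)

op-trueˡ : ∀ {a b} → op true a b ≡ true → a ≡ true
op-trueˡ e = proj₁ (&&-true e)

op-trueʳ : ∀ {a b} → op true a b ≡ true → b ≡ true
op-trueʳ {a} e = proj₂ (&&-true {a} e)

subset? : ∀ s t → (∃ λ x → x ∈ᵗ s × ¬ x ∈ᵗ t) ⊎ (∀ {x} → x ∈ᵗ s → x ∈ᵗ t)
subset? (cst b) t = inj₂ λ ()
subset? (at x)  t with x ∈ᵗ? t
... | yes i = inj₂ λ { here → i }
... | no ¬i = inj₁ (x , here , ¬i)
subset? (nd o r s) t with subset? r t | subset? s t
... | inj₁ (x , i , n) | _ = inj₁ (x , inˡ i , n)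
... | inj₂ _ | inj₁ (x , i , n) = inj₁ (x , inʳ i , n)
... | inj₂ f | inj₂ g = inj₂ λ { (inˡ i) → f i ; (inʳ i) → g i }

Goal-dual : Goal P s t → Goal P (dualᵗ t) (dualᵗ s)
Goal-dual {s = s} {t = t} (goal p q a b h) =
  goal (Ok-dual q) (Ok-dual p) (subst (_≤ 7) (sym (size-dual t)) b) (subst (_≤ 7) (sym (size-dual s)) a)
       (dual-≤ᵗ {s} {t} h)

weight-dual : (g : Goal P s t) → weight (Goal-dual g) ≡ weight g
weight-dual {s = s} {t = t} _ = trans (cong₂ _+_ (size-dual t) (size-dual s)) (ℕₚ.+-comm (size t) (size s))

Solved : ℕ → Set₁
Solved m = ∀ {P φ ψ} (g : Goal P φ ψ) → weight g < m → D P φ ψ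

module Steps {m : ℕ} (ih : Solved m) where

  -- Weight `m` itself is allowed here, while `ih` asks for less. So moves that keep the weight,
  -- such as dualising, renaming or a switch, can be chained before a move that lowers it.
  Step≤ : (ℕ → Set) → Tree → Tree → Set
  Step≤ P φ ψ = (g : Goal P φ ψ) → weight g ≤ m → D P φ ψ

  dually : Step≤ P (dualᵗ t) (dualᵗ s) → Step≤ P s t
  dually f g n = D-undual (f (Goal-dual g) (subst (_≤ m) (sym (weight-dual g)) n))

  -- `ψ` does not see the variables outside it, so setting them to `⊤` in `φ` by weakening keeps the
  -- entailment; the loss of `x` lowers the weight.
  missing : ∀ φ ψ → x ∈ᵗ φ → ¬ x ∈ᵗ ψ → Step≤ P φ ψ
  missing {x} φ ψ i ¬i (goal p q a b h) n =
    restr-up K φ p ◅◅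
    ih (goal (restr-Ok p) q (ℕₚ.≤-trans (restr-size K true φ) a) b below)
       (ℕₚ.<-≤-trans (ℕₚ.+-monoˡ-< (size ψ) (restr-size< K true i (dec-false (x ∈ᵗ? ψ) ¬i))) n)
    where
    K : ℕ → Bool
    K y = does (y ∈ᵗ? ψ)
    below : restr K true φ ≤ᵗ ψ
    below β e = trans (ev-cong ψ λ {y} j → kept y j) (h _ (trans (sym (restr-ev β K true φ)) e))
      where
      kept : ∀ y → y ∈ᵗ ψ → β y ≡ (if K y then β y else true)
      kept y j rewrite dec-true (y ∈ᵗ? ψ) j = refl

  -- Each restriction of `φ` may be as large as `φ`. The weight drops because the conjunct left out
  -- on the right is free of constants and therefore has an atom.
  conjunction : ∀ φ {ψ₁ ψ₂} → ConstFree ψ₁ → ConstFree ψ₂ → Step≤ P φ (nd true ψ₁ ψ₂)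
  conjunction {P} φ {ψ₁} {ψ₂} f₁ f₂ (goal p (nd q₁ q₂ d) a b h) n =
    project K φ p ◅◅
    D-cong proj₁ proj₁ apart (restr-Ok-K p) (restr-Ok-K p)
      (ih (goal (restr-Ok-K p) (Ok-restrict q₁ λ {y} i → Ok-∈ q₁ i , dec-true (y ∈ᵗ? ψ₁) i)
             (ℕₚ.≤-trans (restr-size K true φ) a) (ℕₚ.≤-trans (ℕₚ.m≤m+n _ _) b) below₁)
          (ℕₚ.<-≤-trans (ℕₚ.+-mono-≤-< (restr-size K true φ)
             (ℕₚ.m<m+n (size ψ₁) (size>0 f₂))) n))
      (ih (goal (restr-Ok-K p) (Ok-restrict q₂ λ {y} i → Ok-∈ q₂ i , outside i)
             (ℕₚ.≤-trans (restr-size K′ true φ) a) (ℕₚ.≤-trans (ℕₚ.m≤n+m _ _) b) below₂)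
          (ℕₚ.<-≤-trans (ℕₚ.+-mono-≤-< (restr-size K′ true φ)
             (ℕₚ.m<n+m (size ψ₂) (size>0 f₁))) n))
    where
    K K′ : ℕ → Bool
    K y = does (y ∈ᵗ? ψ₁)
    K′ = not ∘ K
    outside : y ∈ᵗ ψ₂ → K′ y ≡ true
    outside {y} i = cong not (dec-false (y ∈ᵗ? ψ₁) λ j → d j i)
    apart : P x × K x ≡ true → P x × K′ x ≡ true → Empty
    apart (_ , e) (_ , e′) rewrite e with e′
    ... | ()
    below₁ : restr K true φ ≤ᵗ ψ₁
    below₁ β e = trans (ev-cong ψ₁ λ {y} j → kept y j)
                       (op-trueˡ (h _ (trans (sym (restr-ev β K true φ)) e)))
      where
      kept : ∀ y → y ∈ᵗ ψ₁ → β y ≡ (if K y then β y else true)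
      kept y j rewrite dec-true (y ∈ᵗ? ψ₁) j = refl
    below₂ : restr K′ true φ ≤ᵗ ψ₂
    below₂ β e = trans (ev-cong ψ₂ λ {y} j → kept y j)
                       (op-trueʳ {ev _ ψ₁} (h _ (trans (sym (restr-ev β K′ true φ)) e)))
      where
      kept : ∀ y → y ∈ᵗ ψ₂ → β y ≡ (if K′ y then β y else true)
      kept y j rewrite outside j = refl

  disjunction : ∀ ψ {φ₁ φ₂} → ConstFree φ₁ → ConstFree φ₂ → Step≤ P (nd false φ₁ φ₂) ψ
  disjunction ψ f₁ f₂ = dually (conjunction (dualᵗ ψ) (ConstFree-dual f₁) (ConstFree-dual f₂))

  halfStep : ∀ φ ψ → Half φ ψ → ConstFree φ → (∀ {x} → x ∈ᵗ φ → x ∈ᵗ ψ) → Step≤ P φ ψ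
  halfStep {P} φ ψ (literal x r e) f φ⊆ψ (goal p q a b h) n with ≈-Ok e p
  ... | nd (at px) p₂ d =
    acD p e ◅◅
    -- The bound `Rest` excludes `x`, so that no formula of the inner derivation clashes with the
    -- `x` standing beside it.
    D-congʳ {R = Rest} proj₁ (at px) fresh
      (ih (goal (Ok-restrict p₂ λ {y} j → Ok-∈ p₂ j , ≢ᵇ-true {x} {y} λ { refl → d here j }) (restr-Ok-K q)
            (ℕₚ.≤-trans (ℕₚ.<⇒≤ smaller) a) (ℕₚ.≤-trans (restr-size (≢ᵇ x) true ψ) b) below)
          (ℕₚ.<-≤-trans (ℕₚ.+-mono-<-≤ smaller (restr-size (≢ᵇ x) true ψ)) n)) ◅◅
    deepSwitch (φ⊆ψ (≈-∈ (≈sym e) (inˡ here))) q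
    where
    Rest : ℕ → Set
    Rest y = P y × ≢ᵇ x y ≡ true
    fresh : ∀ {y} → Rest y → y ∈ᵗ at x → Empty
    fresh (_ , k) here with trans (sym (≢ᵇ-refl x)) k
    ... | ()
    smaller : size r < size φ
    smaller = ℕₚ.≤-reflexive (sym (≈-size e))
    below : r ≤ᵗ restr (≢ᵇ x) true ψ
    below β k = trans (restr-ev β (≢ᵇ x) true ψ)
      (h γ (trans (≈-ev γ e) (cong₂ _&&_ at-x (ev-mono r (λ {y} _ → raised y) k))))
      where
      γ : Assignment
      γ y = if ≢ᵇ x y then β y else true
      at-x : γ x ≡ true
      at-x rewrite ≢ᵇ-refl x = refl
      raised : ∀ y → β y ≡ true → γ y ≡ true
      raised y k with ≢ᵇ x y
      ... | true  = k
      ... | false = refl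
  halfStep {P} φ ψ (drop c r e h′) f φ⊆ψ (goal p q a b h) n with ≈-Ok e p | ≈-ConstFree e f
  ... | nd p₁ p₂ d | nd f₁ f₂ =
    acD p e ◅◅
    D-congʳ (Ok-∈ p₂) p₁ (λ i j → d j i) (weaken (Ok-self p₂)) ◅◅
    step unitE (nd p₁ cst λ _ ()) p₁ ◅◅
    ih (goal p₁ q (ℕₚ.≤-trans (ℕₚ.<⇒≤ smaller) a) b h′) (ℕₚ.<-≤-trans (ℕₚ.+-monoˡ-< (size ψ) smaller) n)
    where
    smaller : size c < size φ
    smaller = ℕₚ.<-≤-trans (ℕₚ.m<m+n (size c) (size>0 f₂)) (ℕₚ.≤-reflexive (sym (≈-size e)))
  halfStep {P} φ ψ (split r p₀ q₀ e h′) f φ⊆ψ (goal p q a b h) n with ≈-Ok e p | ≈-ConstFree e f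
  ... | k | nd f₁ (nd f₂ f₃) =
    acD p e ◅◅ D-switch k ◅◅
    disjunction ψ (nd f₁ f₂) f₃
      (goal (D-target k (D-switch k)) q (subst (_≤ 7) (sym same) a) b below)
      (subst (λ i → i + size ψ ≤ m) (sym same) n)
    where
    same : size r + size p₀ + size q₀ ≡ size φ
    same = trans (ℕₚ.+-assoc (size r) _ _) (sym (≈-size e))
    below : nd false (nd true r p₀) q₀ ≤ᵗ ψ
    below β g with ||-true {ev β r && ev β p₀} g
    ... | inj₂ i = h′ β i
    ... | inj₁ i = h β (trans (≈-ev β e) (cong₂ _&&_ (proj₁ (&&-true i))
                     (||-trueˡ (ev β q₀) (proj₂ (&&-true {ev β r} i)))))

-- Enumeration of trees up to associativity and commutativity

-- The trees on xs in which the left argument of every chain of o-nodes is not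
-- an o-node.  It holds the first variable of xs, and divide lists the ways in
-- which the other variables are shared out.  The fuel is the length of xs.
module Enumerate (divide : List ℕ → List (List ℕ × List ℕ)) where

  rooted : ℕ → Bool → List ℕ → List Tree
  component : ℕ → Bool → List ℕ → List Tree
  trees : ℕ → List ℕ → List Tree

  rooted (suc k) o (x ∷ xs) =
    concatMap (λ p → cartesianProductWith (λ r c → nd o c r) (trees k (proj₂ p)) (component k (not o) (x ∷ proj₁ p)))
              (divide xs)
  rooted _ _ _ = []

  component k o (x ∷ []) = at x ∷ []
  component k o xs       = rooted k o xs

  trees k (x ∷ []) = at x ∷ []
  trees k xs       = rooted k true xs ++ rooted k false xs

data NotRoot (o : Bool) : Tree → Set where
  at : NotRoot o (at x)
  nd : NotRoot o (nd (not o) s t)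

-- What completeness of an enumeration needs from a way of sharing out variables, stated once for
-- `splits` and `prefixes`. The strict loss in `head<` holds because the rest takes at least one
-- variable.
record Decomposition (divide : List ℕ → List (List ℕ × List ℕ)) (Fits : Tree → List ℕ → Set)
                     (o : Bool) (t : Tree) (xs : List ℕ) : Set where
  constructor decomposition
  field
    {first}     : ℕ
    {ys as bs}  : List ℕ
    {head rest} : Tree
    shape       : xs ≡ first ∷ ys
    equivalent  : t ≈ nd o head rest
    not-root    : NotRoot o head
    divided     : (as , bs) ∈ divide ys
    fits-head   : Fits head (first ∷ as)
    fits-rest   : Fits rest bs
    head<       : length (first ∷ as) ≤ length ys
    rest<       : length bs ≤ length ys

module Complete
  (divide : List ℕ → List (List ℕ × List ℕ)) (Fits : Tree → List ℕ → Set)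
  (fits-cst : ∀ {b xs} → ¬ Fits (cst b) xs)
  (fits-at : ∀ {x xs} → Fits (at x) xs → xs ≡ x ∷ [])
  (fits-nd : ∀ {o s t xs} → Fits (nd o s t) xs → Decomposition divide Fits o (nd o s t) xs) where

  open Enumerate divide

  Found : Tree → List Tree → Set
  Found t ts = ∃ λ t′ → t′ ∈ ts × t ≈ t′

  rooted-complete : ∀ k {o s t xs} → length xs ≤ k → Fits (nd o s t) xs →
                    ∃₂ λ s′ t′ → nd o s′ t′ ∈ rooted k o xs × nd o s t ≈ nd o s′ t′
  component-complete : ∀ k {o t xs} → length xs ≤ k → NotRoot o t → Fits t xs → Found t (component k (not o) xs)
  trees-complete : ∀ k t {xs} → length xs ≤ k → Fits t xs → Found t (trees k xs)

  rooted-complete k n f with fits-nd f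
  rooted-complete (suc k) (s≤s n) f | decomposition refl e nr i fc fr lc lr
    with component-complete k (ℕₚ.≤-trans lc n) nr fc | trees-complete k _ (ℕₚ.≤-trans lr n) fr
  ... | c′ , ic , ec | r′ , ir , er =
    _ , _ ,
    ∈ₚ.∈-concatMap⁺ (λ p → cartesianProductWith _ (trees k (proj₂ p)) (component k _ (_ ∷ proj₁ p)))
      (Any.map (λ { refl → ∈ₚ.∈-cartesianProductWith⁺ _ ir ic }) i) ,
    ≈trans e (≈cong ec er)

  component-complete k n at f with fits-at f
  ... | refl = _ , Any.here refl , ≈refl
  component-complete k {xs = xs} n nd f with fits-nd f
  component-complete k {xs = _ ∷ []} n nd f | decomposition refl _ _ _ _ _ () _
  component-complete k {xs = _ ∷ _ ∷ _} n nd f | _ with rooted-complete k n f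
  ... | _ , _ , i , e = _ , i , e
  component-complete k {xs = []} n nd f | decomposition () _ _ _ _ _ _ _

  trees-complete k (cst b) n f = ⊥-elim (fits-cst f)
  trees-complete k (at x) n f with fits-at f
  ... | refl = _ , Any.here refl , ≈refl
  trees-complete k (nd o s t) {xs} n f with fits-nd f
  trees-complete k (nd o s t) {[]} n f | decomposition () _ _ _ _ _ _ _
  trees-complete k (nd o s t) {_ ∷ []} n f | decomposition refl _ _ _ _ _ () _
  trees-complete k (nd true s t) {_ ∷ _ ∷ _} n f | _ with rooted-complete k n f
  ... | _ , _ , i , e = _ , ∈ₚ.∈-++⁺ˡ i , e
  trees-complete k (nd false s t) {xs@(_ ∷ _ ∷ _)} n f | _ with rooted-complete k n f
  ... | _ , _ , i , e = _ , ∈ₚ.∈-++⁺ʳ (rooted k true xs) i , e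

≢⇒NotRoot : ∀ {o o′} → o ≢ o′ → NotRoot o (nd o′ s t)
≢⇒NotRoot {o = true}  {true}  n = ⊥-elim (n refl)
≢⇒NotRoot {o = true}  {false} n = nd
≢⇒NotRoot {o = false} {true}  n = nd
≢⇒NotRoot {o = false} {false} n = ⊥-elim (n refl)

-- Trees on a set of variables, in any order

splits : List ℕ → List (List ℕ × List ℕ)
splits []       = ([] , []) ∷ []
splits (x ∷ xs) =
  map (λ p → (x ∷ proj₁ p , proj₂ p)) (splits xs) ++ map (λ p → (proj₁ p , x ∷ proj₂ p)) (splits xs)

filter-splits : ∀ {p} {P : ℕ → Set p} (P? : ∀ x → Dec (P x)) xs → (filter P? xs , filter (¬? ∘ P?) xs) ∈ splits xs
filter-splits P? [] = Any.here refl
filter-splits P? (x ∷ xs) with P? x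
... | yes _ = ∈ₚ.∈-++⁺ˡ (∈ₚ.∈-map⁺ _ (filter-splits P? xs))
... | no  _ = ∈ₚ.∈-++⁺ʳ (map _ (splits xs)) (∈ₚ.∈-map⁺ _ (filter-splits P? xs))

record On (t : Tree) (xs : List ℕ) : Set where
  constructor on
  field
    linear : Ok (_∈ᵗ t) t
    const-free : ConstFree t
    unique : Unique xs
    to     : ∀ {x} → x ∈ᵗ t → x ∈ xs
    from   : ∀ {x} → x ∈ xs → x ∈ᵗ t

pull : ∀ s {t} → x ∈ᵗ s → ∃₂ λ c r → nd o s t ≈ nd o c r × NotRoot o c × x ∈ᵗ c
pull (at _) here = _ , _ , ≈refl , at , here
pull {o = o} (nd o′ s₁ s₂) i with o 𝔹ₚ.≟ o′
... | no n = _ , _ , ≈refl , ≢⇒NotRoot n , i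
pull (nd o s₁ s₂) (inˡ i) | yes refl with pull s₁ i
... | c , r , e , n , j = c , r , ≈trans ≈assoc e , n , j
pull (nd o s₁ s₂) (inʳ i) | yes refl with pull s₂ i
... | c , r , e , n , j = c , r , ≈trans (≈cong ≈comm ≈refl) (≈trans ≈assoc e) , n , j

∈⇒length>0 : x ∈ xs → 0 < length xs
∈⇒length>0 (Any.here _)  = s≤s z≤n
∈⇒length>0 (Any.there _) = s≤s z≤n

on-cst : ¬ On (cst b) xs
on-cst (on _ () _ _ _)

on-at : On (at x) xs → xs ≡ x ∷ []
on-at {xs = []} (on _ _ _ to _) with to here
... | ()
on-at {xs = y ∷ []} (on _ _ _ _ from) with from (Any.here refl)
... | here = refl
on-at {xs = y ∷ z ∷ _} (on _ _ ((n ∷ _) ∷ _) _ from) with from (Any.here refl) | from (Any.there (Any.here refl))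
... | here | here = ⊥-elim (n refl)

on-nd : On (nd o s t) xs → Decomposition splits On o (nd o s t) xs
on-nd {xs = []} (on _ f _ to _) with to (proj₂ (member f))
... | ()
on-nd {o} {s} {t} {xs = x ∷ ys} (on l f (n ∷ u) to from) with pulled (from (Any.here refl))
  where
  pulled : ∀ {x} → x ∈ᵗ nd o s t → ∃₂ λ c r → nd o s t ≈ nd o c r × NotRoot o c × x ∈ᵗ c
  pulled (inˡ i) = pull s i
  pulled (inʳ i) with pull t i
  ... | c , r , e , n , j = c , r , ≈trans ≈comm e , n , j
... | c , r , e , nr , i with ≈-Ok e l | ≈-ConstFree e f
... | nd lc lr d | nd fc fr =
  decomposition refl e nr (filter-splits (_∈ᵗ? c) ys)
    (on (Ok-self lc) fc (Allₚ.filter⁺ (_∈ᵗ? c) n ∷ Uniq.filter⁺ (_∈ᵗ? c) u) to-c from-c)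
    (on (Ok-self lr) fr (Uniq.filter⁺ (¬? ∘ (_∈ᵗ? c)) u) to-r from-r)
    (ℕₚ.≤-trans (ℕₚ.≤-reflexive (ℕₚ.+-comm 1 _))
      (ℕₚ.≤-trans (ℕₚ.+-monoʳ-≤ _ (∈⇒length>0 (to-r (proj₂ (member fr)))))
        (ℕₚ.≤-reflexive (length-split (_∈ᵗ? c) ys))))
    (Listₚ.length-filter (¬? ∘ (_∈ᵗ? c)) ys)
  where
  to-c : ∀ {y} → y ∈ᵗ c → y ∈ x ∷ filter (_∈ᵗ? c) ys
  to-c j with to (≈-∈ (≈sym e) (inˡ j))
  ... | Any.here refl = Any.here refl
  ... | Any.there k   = Any.there (∈ₚ.∈-filter⁺ (_∈ᵗ? c) k j)
  from-c : ∀ {y} → y ∈ x ∷ filter (_∈ᵗ? c) ys → y ∈ᵗ c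
  from-c (Any.here refl) = i
  from-c (Any.there k)   = proj₂ (∈ₚ.∈-filter⁻ (_∈ᵗ? c) {xs = ys} k)
  to-r : ∀ {y} → y ∈ᵗ r → y ∈ filter (¬? ∘ (_∈ᵗ? c)) ys
  to-r j with to (≈-∈ (≈sym e) (inʳ j))
  ... | Any.here refl = ⊥-elim (d i j)
  ... | Any.there k   = ∈ₚ.∈-filter⁺ (¬? ∘ (_∈ᵗ? c)) k λ h → d h j
  from-r : ∀ {y} → y ∈ filter (¬? ∘ (_∈ᵗ? c)) ys → y ∈ᵗ r
  from-r k with ∈ₚ.∈-filter⁻ (¬? ∘ (_∈ᵗ? c)) {xs = ys} k
  ... | k′ , ¬h with ≈-∈ e (from (Any.there k′))
  ...   | inˡ h = ⊥-elim (¬h h)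
  ...   | inʳ j = j

module Labelled = Enumerate splits
module LabelledComplete = Complete splits On on-cst on-at on-nd

-- Trees whose leaves come in a given order

prefixes : List ℕ → List (List ℕ × List ℕ)
prefixes []       = ([] , []) ∷ []
prefixes (x ∷ xs) = ([] , x ∷ xs) ∷ map (λ p → (x ∷ proj₁ p , proj₂ p)) (prefixes xs)

++-prefixes : ∀ xs ys → (xs , ys) ∈ prefixes (xs ++ ys)
++-prefixes []       []       = Any.here refl
++-prefixes []       (y ∷ ys) = Any.here refl
++-prefixes (x ∷ xs) ys       = Any.there (∈ₚ.∈-map⁺ _ (++-prefixes xs ys))

-- Renaming can make the leaves of one side read `0, 1, …` from left to right. Only the other side
-- then has to range over all labellings, which keeps the search feasible.
Reads : Tree → List ℕ → Set
Reads t xs = ConstFree t × vars t ≡ xs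

-- Reassociation alone reaches the first component, so the order of the leaves survives.
pull-first : ∀ s {t} → ConstFree s → ConstFree t → ∃₂ λ c r → nd o s t ≈ nd o c r × NotRoot o c ×
             ConstFree c × ConstFree r × vars c ++ vars r ≡ vars s ++ vars t
pull-first (at x) f g = _ , _ , ≈refl , at , f , g , refl
pull-first {o} (nd o′ s₁ s₂) f g with o 𝔹ₚ.≟ o′
... | no n = _ , _ , ≈refl , ≢⇒NotRoot n , f , g , refl
pull-first (nd o s₁ s₂) {t} (nd f₁ f₂) g | yes refl with pull-first s₁ f₁ (nd {o = o} f₂ g)
... | c , r , e , n , fc , fr , q =
  c , r , ≈trans ≈assoc e , n , fc , fr , trans q (sym (Listₚ.++-assoc (vars s₁) (vars s₂) (vars t)))

reads-cst : ¬ Reads (cst b) xs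
reads-cst (() , _)

reads-at : Reads (at x) xs → xs ≡ x ∷ []
reads-at (_ , refl) = refl

reads-nd : Reads (nd o s t) xs → Decomposition prefixes Reads o (nd o s t) xs
reads-nd {s = s} (nd f g , refl) with pull-first s f g
... | c , r , e , n , fc , fr , q with vars c in ec | ∈-vars (proj₂ (member fc))
... | x ∷ as | _ =
  decomposition (sym q) e n (++-prefixes as (vars r)) (fc , ec) (fr , refl)
    (ℕₚ.≤-trans (ℕₚ.≤-reflexive (ℕₚ.+-comm 1 _))
      (ℕₚ.≤-trans (ℕₚ.+-monoʳ-≤ _ (∈⇒length>0 (∈-vars (proj₂ (member fr)))))
        (ℕₚ.≤-reflexive (sym (Listₚ.length-++ as)))))
    (ℕₚ.≤-trans (ℕₚ.m≤n+m _ (length as)) (ℕₚ.≤-reflexive (sym (Listₚ.length-++ as))))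

module Ordered = Enumerate prefixes
module OrderedComplete = Complete prefixes Reads reads-cst reads-at reads-nd

-- Implication by minterms

occurs : List ℕ → Assignment
occurs []       x = false
occurs (y ∷ ys) x = (x ≡ᵇ y) || occurs ys x

-- The products of the disjunctive normal form. Trees are monotone, so an implication need only be
-- tested where one product is true and all other variables are false.
minterms : Tree → List (List ℕ)
minterms (cst true)     = [] ∷ []
minterms (cst false)    = []
minterms (at x)         = (x ∷ []) ∷ []
minterms (nd true s t)  = cartesianProductWith _++_ (minterms s) (minterms t)
minterms (nd false s t) = minterms s ++ minterms t

every : ∀ {A : Set} → (A → Bool) → List A → Bool
every p []       = true
every p (x ∷ xs) = p x && every p xs

every-∈ : ∀ {A : Set} {p : A → Bool} {x xs} → every p xs ≡ true → x ∈ xs → p x ≡ true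
every-∈ e (Any.here refl) = proj₁ (&&-true e)
every-∈ {p = p} {xs = y ∷ _} e (Any.there i) = every-∈ (proj₂ (&&-true {p y} e)) i

every-all : ∀ {A : Set} {p : A → Bool} xs → (∀ {x} → x ∈ xs → p x ≡ true) → every p xs ≡ true
every-all []       f = refl
every-all (x ∷ xs) f = cong₂ _&&_ (f (Any.here refl)) (every-all xs (f ∘ Any.there))

allTrue : List (List ℕ) → Tree → Bool
allTrue Ns t = every (λ N → ev (occurs N) t) Ns

occurs-++⁻ : ∀ M {N} → occurs (M ++ N) x ≡ true → occurs M x ≡ true ⊎ occurs N x ≡ true
occurs-++⁻ []      e = inj₂ e
occurs-++⁻ {x} (y ∷ M) e with does (x ≟ y)
... | true  = inj₁ refl
... | false = occurs-++⁻ M e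

occurs-++⁺ˡ : ∀ M {N} → occurs M x ≡ true → occurs (M ++ N) x ≡ true
occurs-++⁺ˡ {x} (y ∷ M) e with does (x ≟ y)
... | true  = refl
... | false = occurs-++⁺ˡ M e

occurs-++⁺ʳ : ∀ M {N} → occurs N x ≡ true → occurs (M ++ N) x ≡ true
occurs-++⁺ʳ []      e = e
occurs-++⁺ʳ {x} (y ∷ M) e = ||-trueʳ (does (x ≟ y)) (occurs-++⁺ʳ M e)

minterm-true : ∀ t {N} → N ∈ minterms t → ev (occurs N) t ≡ true
minterm-true (cst true) i = refl
minterm-true (at x) (Any.here refl) rewrite dec-true (x ≟ x) refl = refl
minterm-true (nd true s t) i with ∈ₚ.∈-cartesianProductWith⁻ _++_ (minterms s) (minterms t) i
... | M , N , j , k , refl = cong₂ _&&_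
  (ev-mono s (λ _ → occurs-++⁺ˡ M) (minterm-true s j)) (ev-mono t (λ _ → occurs-++⁺ʳ M) (minterm-true t k))
minterm-true (nd false s t) i with ∈ₚ.∈-++⁻ (minterms s) i
... | inj₁ j = ||-trueˡ _ (minterm-true s j)
... | inj₂ j = ||-trueʳ _ (minterm-true t j)

minterm-below : ∀ {β} t → ev β t ≡ true →
                ∃ λ N → N ∈ minterms t × (∀ {x} → occurs N x ≡ true → β x ≡ true)
minterm-below (cst true) e = [] , Any.here refl , λ ()
minterm-below {β} (at y) e = y ∷ [] , Any.here refl , λ {x} → single x
  where
  single : ∀ x → occurs (y ∷ []) x ≡ true → β x ≡ true
  single x h with x ≟ y
  ... | yes refl = e
  ... | no ne rewrite dec-false (x ≟ y) ne with h
  ... | ()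
minterm-below {β} (nd true s t) e
  with minterm-below s (op-trueˡ e) | minterm-below t (op-trueʳ {ev β s} e)
... | M , i , f | N , j , g =
  M ++ N , ∈ₚ.∈-cartesianProductWith⁺ _++_ i j , λ h → [ f , g ]′ (occurs-++⁻ M h)
minterm-below {β} (nd false s t) e with ||-true {ev β s} e
... | inj₁ e₁ with minterm-below s e₁
...   | N , i , f = N , ∈ₚ.∈-++⁺ˡ i , f
minterm-below {β} (nd false s t) e | inj₂ e₂ with minterm-below t e₂
...   | N , i , f = N , ∈ₚ.∈-++⁺ʳ (minterms s) i , f

allTrue-complete : ∀ s t → s ≤ᵗ t → allTrue (minterms s) t ≡ true
allTrue-complete s t h = every-all (minterms s) λ i → h _ (minterm-true s i)

allTrue-sound : ∀ s t → allTrue (minterms s) t ≡ true → s ≤ᵗ t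
allTrue-sound s t h β e with minterm-below s e
... | N , i , f = ev-mono t (λ _ → f) (every-∈ h i)

-- The finite check

anyComponent : Bool → (Tree → Bool) → Tree → Bool
anyComponent true  p (nd true s t)  = anyComponent true p s || anyComponent true p t
anyComponent false p (nd false s t) = anyComponent false p s || anyComponent false p t
anyComponent _     p t              = p t

HasComponent : Bool → (Tree → Bool) → Tree → Set
HasComponent o p t = ∃₂ λ c r → t ≈ nd o c r × p c ≡ true

anyComponent-sound : ∀ o p t → anyComponent o p t ≡ true → p t ≡ true ⊎ HasComponent o p t
anyComponent-nd : ∀ o p s t → anyComponent o p s || anyComponent o p t ≡ true → HasComponent o p (nd o s t)

anyComponent-sound true  p (cst b)        e = inj₁ e
anyComponent-sound true  p (at x)         e = inj₁ e
anyComponent-sound true  p (nd true s t)  e = inj₂ (anyComponent-nd true p s t e)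
anyComponent-sound true  p (nd false s t) e = inj₁ e
anyComponent-sound false p (cst b)        e = inj₁ e
anyComponent-sound false p (at x)         e = inj₁ e
anyComponent-sound false p (nd true s t)  e = inj₁ e
anyComponent-sound false p (nd false s t) e = inj₂ (anyComponent-nd false p s t e)

anyComponent-nd o p s t e with ||-true {anyComponent o p s} e
... | inj₁ e₁ with anyComponent-sound o p s e₁
...   | inj₁ h = s , t , ≈refl , h
...   | inj₂ (c , r , f , h) = c , nd o r t , ≈trans (≈cong f ≈refl) ≈assoc , h
anyComponent-nd o p s t e | inj₂ e₂ with anyComponent-sound o p t e₂
...   | inj₁ h = t , s , ≈comm , h
...   | inj₂ (c , r , f , h) = c , nd o r s , ≈trans ≈comm (≈trans (≈cong f ≈refl) ≈assoc) , h

isAtom : Tree → Bool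
isAtom (at x) = true
isAtom _      = false

hasAtom : Bool → Tree → Bool
hasAtom o = anyComponent o isAtom

-- A conjunct that is not a disjunction counts as its own only disjunct, so a single test covers
-- both `drop` and `split`.
separable : Tree → Tree → Bool
separable φ ψ = anyComponent true (anyComponent false (λ q → allTrue (minterms q) ψ)) φ

good : Tree → List (List ℕ) → Tree → Bool
good φ Ns ψ = not (allTrue Ns ψ) || (separable φ ψ || separable (dualᵗ ψ) (dualᵗ φ))

-- The minterms of `φ` are passed as an argument so that one computation can serve every `ψ`.
goodAll : List Tree → Tree → List (List ℕ) → Bool
goodAll ψs φ Ns = every (good φ Ns) ψs

checkAll : List Tree → List Tree → Bool
checkAll φs ψs = every (λ φ → hasAtom true φ || goodAll ψs φ (minterms φ)) φs

-- Only a conjunction on the left against a disjunction on the right is left to test; where a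
-- literal is a conjunct of the former or a disjunct of the latter, `literal` applies at once.
check : ℕ → Bool
check n = checkAll (Ordered.rooted n true (upTo n))
                   (filterᵇ (λ t → not (hasAtom false t)) (Labelled.rooted n false (upTo n)))

abstract
  -- Each `refl` runs the whole search for one number of variables; `abstract` keeps it from being
  -- unfolded again elsewhere.
  check-true : ∀ {n} → n ≤ 7 → check n ≡ true
  check-true {0} _ = refl
  check-true {1} _ = refl
  check-true {2} _ = refl
  check-true {3} _ = refl
  check-true {4} _ = refl
  check-true {5} _ = refl
  check-true {6} _ = refl
  check-true {7} _ = refl
  check-true {suc (suc (suc (suc (suc (suc (suc (suc _)))))))} (s≤s (s≤s (s≤s (s≤s (s≤s (s≤s (s≤s ())))))))

half-atom : ∀ ψ → HasComponent true isAtom t → Half t ψ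
half-atom ψ (at x , r , e , _) = literal x r e

half-separable : ∀ s t ψ → separable (nd true s t) ψ ≡ true → Half (nd true s t) ψ
half-separable s t ψ h
  with anyComponent-nd true (anyComponent false (λ q → allTrue (minterms q) ψ)) s t h
... | c , r , e , h′ with anyComponent-sound false (λ q → allTrue (minterms q) ψ) c h′
...   | inj₁ k = drop c r e (allTrue-sound c ψ k)
...   | inj₂ (q , p , f , k) = split r p q
  (≈trans e (≈trans ≈comm (≈cong ≈refl (≈trans f ≈comm)))) (allTrue-sound q ψ k)

check-half : ∀ n {s t u v} → n ≤ 7 → nd true s t ∈ Ordered.rooted n true (upTo n) →
  nd false u v ∈ Labelled.rooted n false (upTo n) → nd true s t ≤ᵗ nd false u v →
  Half (nd true s t) (nd false u v) ⊎ Half (dualᵗ (nd false u v)) (dualᵗ (nd true s t))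
check-half n {s} {t} {u} {v} n≤7 i j h with hasAtom false (nd false u v) in a
... | true with anyComponent-nd false isAtom u v a
...   | at x , r , e , _ = inj₂ (literal x (dualᵗ r) (≈-dual e))
check-half n {s} {t} {u} {v} n≤7 i j h | false
  with ||-true {hasAtom true (nd true s t)} (every-∈ (check-true n≤7) i)
... | inj₁ b = inj₁ (half-atom _ (anyComponent-nd true isAtom s t b))
... | inj₂ g
  with ||-true {not (allTrue (minterms (nd true s t)) (nd false u v))}
    (every-∈ g (∈ₚ.∈-filter⁺ _ j (subst (T ∘ not) (sym a) _)))
...   | inj₁ b with trans (sym b) (cong not (allTrue-complete (nd true s t) (nd false u v) h))
...     | ()
check-half n {s} {t} {u} {v} n≤7 i j h | false | inj₂ g | inj₂ b
  with ||-true {separable (nd true s t) (nd false u v)} b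
... | inj₁ k = inj₁ (half-separable s t _ k)
... | inj₂ k = inj₂ (half-separable (dualᵗ u) (dualᵗ v) _ k)

-- Renaming to the variables 0, 1, …

rename : (ℕ → ℕ) → Tree → Tree
rename f (cst b)    = cst b
rename f (at x)     = at (f x)
rename f (nd o s t) = nd o (rename f s) (rename f t)

rename-∈ : ∀ f → x ∈ᵗ t → f x ∈ᵗ rename f t
rename-∈ f here    = here
rename-∈ f (inˡ i) = inˡ (rename-∈ f i)
rename-∈ f (inʳ i) = inʳ (rename-∈ f i)

rename-∈⁻ : ∀ f t → y ∈ᵗ rename f t → ∃ λ x → x ∈ᵗ t × y ≡ f x
rename-∈⁻ f (at x) here = x , here , refl
rename-∈⁻ f (nd o s t) (inˡ i) with rename-∈⁻ f s i
... | x , j , e = x , inˡ j , e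
rename-∈⁻ f (nd o s t) (inʳ i) with rename-∈⁻ f t i
... | x , j , e = x , inʳ j , e

rename-size : ∀ f t → size (rename f t) ≡ size t
rename-size f (cst b)    = refl
rename-size f (at x)     = refl
rename-size f (nd o s t) = cong₂ _+_ (rename-size f s) (rename-size f t)

rename-ev : ∀ β f t → ev β (rename f t) ≡ ev (β ∘ f) t
rename-ev β f (cst b)    = refl
rename-ev β f (at x)     = refl
rename-ev β f (nd o s t) = cong₂ (op o) (rename-ev β f s) (rename-ev β f t)

rename-ConstFree : ∀ f → ConstFree t → ConstFree (rename f t)
rename-ConstFree f at       = at
rename-ConstFree f (nd g h) = nd (rename-ConstFree f g) (rename-ConstFree f h)

rename-vars : ∀ f t → vars (rename f t) ≡ map f (vars t)
rename-vars f (cst b)    = refl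
rename-vars f (at x)     = refl
rename-vars f (nd o s t) =
  trans (cong₂ _++_ (rename-vars f s) (rename-vars f t)) (sym (Listₚ.map-++ f (vars s) (vars t)))

rename-inverse : ∀ {f g} t → (∀ {x} → x ∈ᵗ t → g (f x) ≡ x) → rename g (rename f t) ≡ t
rename-inverse (cst b)    h = refl
rename-inverse (at x)     h = cong at (h here)
rename-inverse (nd o s t) h = cong₂ (nd o) (rename-inverse s (h ∘ inˡ)) (rename-inverse t (h ∘ inʳ))

rename-≈ : ∀ f → s ≈ t → rename f s ≈ rename f t
rename-≈ f ≈refl        = ≈refl
rename-≈ f (≈trans d e) = ≈trans (rename-≈ f d) (rename-≈ f e)
rename-≈ f ≈comm        = ≈comm
rename-≈ f ≈assoc       = ≈assoc
rename-≈ f (≈cong d e)  = ≈cong (rename-≈ f d) (rename-≈ f e)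

rename-↝ : ∀ f → s ↝ t → rename f s ↝ rename f t
rename-↝ f (ac e)    = ac (rename-≈ f e)
rename-↝ f unitE     = unitE
rename-↝ f unitI     = unitI
rename-↝ f absE      = absE
rename-↝ f absI      = absI
rename-↝ f switchᵗ   = switchᵗ
rename-↝ f medialᵗ   = medialᵗ
rename-↝ f (congˡ e) = congˡ (rename-↝ f e)
rename-↝ f (congʳ e) = congʳ (rename-↝ f e)

module _ {P Q : ℕ → Set} (f : ℕ → ℕ) (injective : ∀ {x y : ℕ} → P x → P y → f x ≡ f y → x ≡ y)
         (image : ∀ {x : ℕ} → P x → Q (f x)) where

  rename-Ok : Ok P t → Ok Q (rename f t)
  rename-Ok cst    = cst
  rename-Ok (at p) = at (image p)
  rename-Ok (nd {s = s} {t = t} p q d) = nd (rename-Ok p) (rename-Ok q) dis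
    where
    dis : ∀ {x} → x ∈ᵗ rename f s → x ∈ᵗ rename f t → Empty
    dis i j with rename-∈⁻ f s i | rename-∈⁻ f t j
    ... | x , i′ , refl | y , j′ , e with injective (Ok-∈ p i′) (Ok-∈ q j′) e
    ... | refl = d i′ j′

  rename-D : D P s t → D Q (rename f s) (rename f t)
  rename-D = Star.gmap (rename f) λ { (e , p , q) → rename-↝ f e , rename-Ok p , rename-Ok q }

position : List ℕ → ℕ → ℕ
position []       x = 0
position (y ∷ ys) x = if does (x ≟ y) then 0 else suc (position ys x)

nth : List ℕ → ℕ → ℕ
nth []       i       = 0
nth (x ∷ xs) zero    = x
nth (x ∷ xs) (suc i) = nth xs i

nth-position : x ∈ xs → nth xs (position xs x) ≡ x
nth-position {x} {y ∷ ys} i with x ≟ y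
... | yes refl rewrite dec-true (x ≟ x) refl = refl
... | no n rewrite dec-false (x ≟ y) n with i
... | Any.here e  = ⊥-elim (n e)
... | Any.there j = nth-position j

map-position : Unique xs → map (position xs) xs ≡ upTo (length xs)
map-position [] = refl
map-position {x ∷ xs} (n ∷ u) = cong₂ _∷_ first
  (trans (Listₚ.map-cong-local (All.map later n))
    (trans (Listₚ.map-∘ xs) (trans (cong (map suc) (map-position u)) (Listₚ.map-upTo suc (length xs)))))
  where
  first : position (x ∷ xs) x ≡ 0
  first rewrite dec-true (x ≟ x) refl = refl
  later : ∀ {y} → x ≢ y → position (x ∷ xs) y ≡ suc (position xs y)
  later {y} ne rewrite dec-false (y ≟ x) (ne ∘ sym) = refl

vars-unique : Ok P t → Unique (vars t)
vars-unique cst    = []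
vars-unique (at _) = [] ∷ []
vars-unique (nd {s = s} {t = t} p q d) =
  Uniq.++⁺ (vars-unique p) (vars-unique q) λ (i , j) → d (∈-vars⁻ s i) (∈-vars⁻ t j)

vars-length : ConstFree t → length (vars t) ≡ size t
vars-length at = refl
vars-length (nd {s = s} f g) = trans (Listₚ.length-++ (vars s)) (cong₂ _+_ (vars-length f) (vars-length g))

module _ {P : ℕ → Set} {φ₁ φ₂ ψ₁ ψ₂ : Tree}
         (f : ConstFree (nd true φ₁ φ₂)) (g : ConstFree (nd false ψ₁ ψ₂))
         (k : Goal P (nd true φ₁ φ₂) (nd false ψ₁ ψ₂))
         (φ⊆ψ : ∀ {x} → x ∈ᵗ nd true φ₁ φ₂ → x ∈ᵗ nd false ψ₁ ψ₂)
         (ψ⊆φ : ∀ {x} → x ∈ᵗ nd false ψ₁ ψ₂ → x ∈ᵗ nd true φ₁ φ₂) where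

  private
    φ = nd true φ₁ φ₂
    ψ = nd false ψ₁ ψ₂
    V = vars φ
    n = length V
    index = position V

    -- Formulae inside a derivation may hold any variable within the bound, so the bound itself has
    -- to make `nth V` injective and send it into `P`; otherwise the derivation could not be renamed
    -- back.
    Code : ℕ → Set
    Code i = index (nth V i) ≡ i × P (nth V i)

    nth-index : x ∈ᵗ φ → nth V (index x) ≡ x
    nth-index i = nth-position (∈-vars i)

    code : x ∈ᵗ φ → Code (index x)
    code i = cong index (nth-index i) , subst P (sym (nth-index i)) (Ok-∈ (φ-Ok k) i)

    index-injective : x ∈ᵗ φ → y ∈ᵗ φ → index x ≡ index y → x ≡ y
    index-injective i j e = trans (sym (nth-index i)) (trans (cong (nth V) e) (nth-index j))

    range : map index V ≡ upTo n
    range = map-position (vars-unique (φ-Ok k))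

    φ′ ψ′ : Tree
    φ′ = rename index φ
    ψ′ = rename index ψ

    φ′-Ok : Ok Code φ′
    φ′-Ok = rename-Ok index index-injective code (Ok-self (φ-Ok k))

    ψ′-Ok : Ok Code ψ′
    ψ′-Ok = rename-Ok index index-injective code (Ok-restrict (ψ-Ok k) ψ⊆φ)

    ψ′-on : On ψ′ (upTo n)
    ψ′-on = on (Ok-self ψ′-Ok) (rename-ConstFree index g) (Uniq.upTo⁺ n) to from
      where
      to : ∀ {x} → x ∈ᵗ ψ′ → x ∈ upTo n
      to i with rename-∈⁻ index ψ i
      ... | x , j , refl = subst (index x ∈_) range (∈ₚ.∈-map⁺ index (∈-vars (ψ⊆φ j)))
      from : ∀ {x} → x ∈ upTo n → x ∈ᵗ ψ′
      from i with ∈ₚ.∈-map⁻ index (subst (_ ∈_) (sym range) i)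
      ... | x , j , refl = rename-∈ index (φ⊆ψ (∈-vars⁻ φ j))

    back : D Code φ′ ψ′ → D P φ ψ
    back d = subst₂ (D P)
      (rename-inverse φ nth-index) (rename-inverse ψ (λ i → nth-index (ψ⊆φ i)))
      (rename-D (nth V) (λ (e , _) (e′ , _) q → trans (sym e) (trans (cong index q) e′)) proj₂ d)

    upTo-length : length (upTo n) ≤ n
    upTo-length = ℕₚ.≤-reflexive (Listₚ.length-upTo n)

  canonise : Canonical P φ ψ
  canonise
    with OrderedComplete.rooted-complete n upTo-length
           (rename-ConstFree index f , trans (rename-vars index φ) range)
       | LabelledComplete.rooted-complete n upTo-length ψ′-on
  ... | s , t , i , d | u , v , j , e = record
    { canonical   = goal (≈-Ok d φ′-Ok) (≈-Ok e ψ′-Ok)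
                      (subst (_≤ 7) (sym same-φ) (φ-small k)) (subst (_≤ 7) (sym same-ψ) (ψ-small k)) below
    ; same-weight = cong₂ _+_ same-φ same-ψ
    ; φ-free      = ≈-ConstFree d (rename-ConstFree index f)
    ; ψ-free      = ≈-ConstFree e (rename-ConstFree index g)
    ; φ⊆ψ         = λ l → ≈-∈ e (φ⊆ψ′ (≈-∈ (≈sym d) l))
    ; ψ⊆φ         = λ l → ≈-∈ d (ψ⊆φ′ (≈-∈ (≈sym e) l))
    ; half        = check-half n (subst (_≤ 7) (sym (vars-length f)) (φ-small k)) i j below
    ; transfer    = λ c → back (acD φ′-Ok d ◅◅ c ◅◅ acD (≈-Ok e ψ′-Ok) (≈sym e))
    }
    where
    same-φ : size (nd true s t) ≡ size φ
    same-φ = trans (sym (≈-size d)) (rename-size index φ)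
    same-ψ : size (nd false u v) ≡ size ψ
    same-ψ = trans (sym (≈-size e)) (rename-size index ψ)
    below : nd true s t ≤ᵗ nd false u v
    below β h = trans (sym (≈-ev β e)) (trans (rename-ev β index ψ)
      (entails k (β ∘ index) (trans (sym (rename-ev β index φ)) (trans (≈-ev β d) h))))
    φ⊆ψ′ : ∀ {x} → x ∈ᵗ φ′ → x ∈ᵗ ψ′
    φ⊆ψ′ l with rename-∈⁻ index φ l
    ... | x , m , refl = rename-∈ index (φ⊆ψ m)
    ψ⊆φ′ : ∀ {x} → x ∈ᵗ ψ′ → x ∈ᵗ φ′
    ψ⊆φ′ l with rename-∈⁻ index ψ l
    ... | x , m , refl = rename-∈ index (ψ⊆φ m)

-- The inductive step

module _ {m : ℕ} (ih : Solved m) where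
  open Steps ih

  sameVars : ∀ φ ψ → ConstFree φ → ConstFree ψ → (∀ {x} → x ∈ᵗ φ → x ∈ᵗ ψ) → (∀ {x} → x ∈ᵗ ψ → x ∈ᵗ φ) →
             Step≤ P φ ψ
  sameVars (at x) (at y) f g φ⊆ψ ψ⊆φ k n with φ⊆ψ here
  ... | here = ε
  -- A linear node without constants has two different variables and cannot share its variable set
  -- with an atom.
  sameVars (at x) (nd o s t) f (nd g₁ g₂) φ⊆ψ ψ⊆φ (goal p (nd q₁ q₂ d) a b h) n
    with member g₁ | member g₂
  ... | y , i | z , j with ψ⊆φ (inˡ i) | ψ⊆φ (inʳ j)
  ... | here | here = ⊥-elim (d i j)
  sameVars (nd o s t) (at x) (nd f₁ f₂) g φ⊆ψ ψ⊆φ (goal (nd q₁ q₂ d) p a b h) n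
    with member f₁ | member f₂
  ... | y , i | z , j with φ⊆ψ (inˡ i) | φ⊆ψ (inʳ j)
  ... | here | here = ⊥-elim (d i j)
  sameVars φ (nd true ψ₁ ψ₂) f (nd g₁ g₂) φ⊆ψ ψ⊆φ k n = conjunction φ g₁ g₂ k n
  sameVars (nd false φ₁ φ₂) ψ@(nd false _ _) (nd f₁ f₂) g φ⊆ψ ψ⊆φ k n = disjunction ψ f₁ f₂ k n
  sameVars φ@(nd true _ _) ψ@(nd false _ _) f g φ⊆ψ ψ⊆φ k n =
    transfer (advance half canonical (subst (_≤ m) (sym same-weight) n))
    where
    open Canonical (canonise f g k φ⊆ψ ψ⊆φ) renaming (φ⊆ψ to sub; ψ⊆φ to sup)
    advance : Half φ′ ψ′ ⊎ Half (dualᵗ ψ′) (dualᵗ φ′) → Step≤ bound φ′ ψ′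
    advance (inj₁ e) = halfStep φ′ ψ′ e φ-free sub
    advance (inj₂ e) = dually (halfStep (dualᵗ ψ′) (dualᵗ φ′) e (ConstFree-dual ψ-free)
                                (λ i → dual-∈ (sup (dual-∈⁻ ψ′ i))))

  constFree : ∀ φ ψ → ConstFree φ → ConstFree ψ → Step≤ P φ ψ
  constFree φ ψ f g with subset? φ ψ | subset? ψ φ
  ... | inj₁ (x , i , ¬i) | _ = missing φ ψ i ¬i
  ... | inj₂ _ | inj₁ (x , i , ¬i) =
    dually (missing (dualᵗ ψ) (dualᵗ φ) (dual-∈ i) (¬i ∘ dual-∈⁻ φ))
  ... | inj₂ φ⊆ψ | inj₂ ψ⊆φ = sameVars φ ψ f g φ⊆ψ ψ⊆φ

  -- A tree free of constants is true when all variables are and false when none is, so a constant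
  -- not covered by weakening contradicts the entailment.
  normal : ∀ φ ψ → Normal φ → Normal ψ → Step≤ P φ ψ
  normal φ ψ (const false) _ k n = exFalso (ψ-Ok k)
  normal φ ψ _ (const true)  k n = weaken (φ-Ok k)
  normal φ ψ (const true) (const false) k n with entails k (λ _ → true) refl
  ... | ()
  normal φ ψ (const true) (free g) k n with trans (sym (ev-const false g)) (entails k (λ _ → false) refl)
  ... | ()
  normal φ ψ (free f) (const false) k n with entails k (λ _ → true) (ev-const true f)
  ... | ()
  normal φ ψ (free f) (free g) k n = constFree φ ψ f g k n

  -- Restriction to all variables replaces no atom; it serves only to simplify the constants away on
  -- both sides.
  solve-step : ∀ φ ψ → Step≤ P φ ψ
  solve-step φ ψ k@(goal p q a b h) n =
    restr-up all φ p ◅◅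
    normal _ _ (restr-Normal all true φ) (restr-Normal all false ψ)
      (goal (restr-Ok p) (restr-Ok q)
        (ℕₚ.≤-trans (restr-size all true φ) a) (ℕₚ.≤-trans (restr-size all false ψ) b)
        λ β e → trans (restr-ev β all false ψ) (h β (trans (sym (restr-ev β all true φ)) e)))
      (ℕₚ.≤-trans (ℕₚ.+-mono-≤ (restr-size all true φ) (restr-size all false ψ)) n) ◅◅
    restr-down all ψ q
    where
    all : ℕ → Bool
    all _ = true

solved : ∀ m → Solved m
solved (suc m) k (s≤s n) = solve-step (solved m) _ _ k n

solve : ∀ {P} φ ψ → Ok P φ → Ok P ψ → size φ ≤ 7 → size ψ ≤ 7 → φ ≤ᵗ ψ → D P φ ψ
solve φ ψ p q a b h = solved _ (goal p q a b h) ℕₚ.≤-refl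

-- Reduction of the positive half to the common literals

-- `K` keeps a variable only if both sides hold it with the same sign. For opposite signs, the value
-- that makes the literal true in `φ` also makes it false in `ψ`, so replacing the two by ⊤ and ⊥
-- preserves the entailment.
derivable-≤7 : ∀ V₁ V₂ φ ψ → φ LinearOn V₁ → ψ LinearOn V₂ → φ ⊨ ψ →
                length (V₁ ∩ V₂) ≤ 7 → DerivableWithUnits SwitchMedial φ ψ
derivable-≤7 V₁ V₂ φ ψ p q h n = subst₂ (DerivableWithUnits SwitchMedial) eσ eτ
  (D⇒derivable σ (restr-up K l (tree-Ok p)) ◅◅
   -- On `l₁` the two sign functions agree, so from here on everything is read with `τ`.
   subst (λ χ → DerivableWithUnits SwitchMedial χ (⟦ m ⟧ τ)) (sym (⟦⟧-cong l₁ agree))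
    (D⇒derivable τ
      (solve l₁ m₁ l-Ok m-Ok (bound l-Ok) (bound m-Ok) l₁≤m₁) ◅◅
     D⇒derivable τ (restr-down K m (tree-Ok q))))
  where
  σ  = proj₁ (signs p)
  eσ = proj₂ (signs p)
  τ  = proj₁ (signs q)
  eτ = proj₂ (signs q)
  l  = tree φ
  m  = tree ψ
  K : ℕ → Bool
  K x = does (x ∈ᵗ? l) && (does (x ∈ᵗ? m) && does (σ x 𝔹ₚ.≟ τ x))
  l₁ = restr K true l
  m₁ = restr K false m
  K-true : ∀ {x} → K x ≡ true → x ∈ᵗ l × x ∈ᵗ m × σ x ≡ τ x
  K-true {x} e =
    let (e₁ , e₂) = &&-true {does (x ∈ᵗ? l)} e
        (e₃ , e₄) = &&-true {does (x ∈ᵗ? m)} e₂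
    in fromDoes (x ∈ᵗ? l) e₁ , fromDoes (x ∈ᵗ? m) e₃ , fromDoes (σ x 𝔹ₚ.≟ τ x) e₄
  agree : ∀ {x} → x ∈ᵗ l₁ → σ x ≡ τ x
  agree {x} i = proj₂ (proj₂ (K-true {x} (proj₂ (restr-∈ l i))))
  Common : ℕ → Set
  Common x = x ∈ᵗ l × x ∈ᵗ m
  both : ∀ {x} → K x ≡ true → x ∈ᵗ l × x ∈ᵗ m
  both {x} e = proj₁ (K-true {x} e) , proj₁ (proj₂ (K-true {x} e))
  l-Ok : Ok Common l₁
  l-Ok = Ok-restrict (restr-Ok (tree-Ok p)) λ {x} i → both {x} (proj₂ (restr-∈ l i))
  m-Ok : Ok Common m₁
  m-Ok = Ok-restrict (restr-Ok (tree-Ok q)) λ {x} i → both {x} (proj₂ (restr-∈ m i))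
  bound : ∀ {u} → Ok Common u → size u ≤ 7
  bound r = ℕₚ.≤-trans (size-bound (V₁ ∩ V₂) (Ok-mono (λ (i , j) →
    ∈ₚ.∈-filter⁺ (λ x → mem? _≟_ x V₂) (tree-∈ p i) (tree-∈ q j)) r)) n
  -- The literals that are not common to both sides: true in φ, false in ψ.
  α : Assignment → Assignment
  α β x = if K x then signed (σ x) (β x) else if does (x ∈ᵗ? l) then σ x else not (τ x)
  signed-self : ∀ b → signed b b ≡ true
  signed-self true  = refl
  signed-self false = refl
  signed-not : ∀ b → signed b (not b) ≡ false
  signed-not true  = refl
  signed-not false = refl
  signed-≢ : ∀ {a b} → a ≢ b → signed b a ≡ false
  signed-≢ {true}  {true}  n = ⊥-elim (n refl)
  signed-≢ {true}  {false} n = refl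
  signed-≢ {false} {true}  n = refl
  signed-≢ {false} {false} n = ⊥-elim (n refl)
  signed² : ∀ a b → signed a (signed a b) ≡ b
  signed² true  b = refl
  signed² false b = 𝔹ₚ.not-involutive b
  onˢ : ∀ β → x ∈ᵗ l → (if K x then β x else true) ≡ signed (σ x) (α β x)
  onˢ {x} β i with x ∈ᵗ? l | x ∈ᵗ? m | σ x 𝔹ₚ.≟ τ x
  ... | no ¬i | _     | _     = contradiction i ¬i
  ... | yes _ | no _  | _     = sym (signed-self (σ x))
  ... | yes _ | yes _ | no _  = sym (signed-self (σ x))
  ... | yes _ | yes _ | yes _ = sym (signed² (σ x) (β x))
  onᵗ : ∀ β → x ∈ᵗ m → signed (τ x) (α β x) ≡ (if K x then β x else false)
  onᵗ {x} β i with x ∈ᵗ? l | x ∈ᵗ? m | σ x 𝔹ₚ.≟ τ x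
  ... | _     | no ¬i | _     = contradiction i ¬i
  ... | no _  | yes _ | _     = signed-not (τ x)
  ... | yes _ | yes _ | no ne = signed-≢ ne
  ... | yes _ | yes _ | yes e = trans (cong (λ a → signed (τ x) (signed a (β x))) e) (signed² (τ x) (β x))
  l₁≤m₁ : l₁ ≤ᵗ m₁
  l₁≤m₁ β e = trans (restr-ev β K false m) (trans (sym (ev-cong m (onᵗ β)))
    (trans (sym (⟦⟧-eval (α β) τ m)) (trans (cong (eval (α β)) eτ) (h (α β)
      (trans (sym (cong (eval (α β)) eσ)) (trans (⟦⟧-eval (α β) σ l)
        (trans (sym (ev-cong l (onˢ β))) (trans (sym (restr-ev β K true l)) e))))))))

-- Meets of two variables

-- In a linear tree, `o` is the connective at the lowest common ancestor of `x` and `y`.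
data Meet (o : Bool) (x y : ℕ) : Tree → Set where
  meet  : x ∈ᵗ s → y ∈ᵗ t → Meet o x y (nd o s t)
  meet′ : y ∈ᵗ s → x ∈ᵗ t → Meet o x y (nd o s t)
  inˡ   : Meet o x y s → Meet o x y (nd b s t)
  inʳ   : Meet o x y t → Meet o x y (nd b s t)

meets : x ∈ᵗ t → y ∈ᵗ t → x ≢ y → Meet true x y t ⊎ Meet false x y t
meets here here n = ⊥-elim (n refl)
meets (inˡ i) (inˡ j) n = [ inj₁ ∘ inˡ , inj₂ ∘ inˡ ]′ (meets i j n)
meets (inʳ i) (inʳ j) n = [ inj₁ ∘ inʳ , inj₂ ∘ inʳ ]′ (meets i j n)
meets (inˡ {o = true}  i) (inʳ j) n = inj₁ (meet i j)
meets (inˡ {o = false} i) (inʳ j) n = inj₂ (meet i j)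
meets (inʳ {o = true}  i) (inˡ j) n = inj₁ (meet′ j i)
meets (inʳ {o = false} i) (inˡ j) n = inj₂ (meet′ j i)

Meet-∈ : Meet o x y t → x ∈ᵗ t × y ∈ᵗ t
Meet-∈ (meet i j)  = inˡ i , inʳ j
Meet-∈ (meet′ j i) = inʳ i , inˡ j
Meet-∈ (inˡ m) = inˡ (proj₁ (Meet-∈ m)) , inˡ (proj₂ (Meet-∈ m))
Meet-∈ (inʳ m) = inʳ (proj₁ (Meet-∈ m)) , inʳ (proj₂ (Meet-∈ m))

-- Under some assignment to the other variables, t is x ∧ y (for o = true) or
-- x ∨ y (for o = false), up to the signs of x and y.
record Shows (o : Bool) (x y : ℕ) (f : Assignment → Bool) : Set where
  constructor shows
  field
    {α αˣ αʸ} : Assignment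
    agreeˣ    : ∀ z → z ≢ x → α z ≡ αˣ z
    agreeʸ    : ∀ z → z ≢ y → α z ≡ αʸ z
    corner    : f α ≡ o
    neighborˣ : f αˣ ≡ not o
    neighborʸ : f αʸ ≡ not o

Shows-∈ : Shows o x y (λ α → ev α t) → x ∈ᵗ t × y ∈ᵗ t
Shows-∈ {o} {x} {y} {t} (shows ax ay c nx ny) = occurring ax nx , occurring ay ny
  where
  differ : ∀ o → o ≢ not o
  differ true  ()
  differ false ()
  occurring : ∀ {z β} → (∀ w → w ≢ z → _ ≡ β w) → ev β t ≡ not o → z ∈ᵗ t
  occurring {z} a n with z ∈ᵗ? t
  ... | yes i = i
  ... | no ¬i = ⊥-elim (differ o (trans (sym c) (trans (ev-cong t λ {w} i → a w λ { refl → ¬i i }) n)))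

op-unit : ∀ o {a b} → op o a b ≡ o → a ≡ o × b ≡ o
op-unit true  {true}  e = refl , e
op-unit false {false} e = refl , e

op-cancel : ∀ b o k {p p₁ p₂} → op b k p ≡ o → op b k p₁ ≡ not o → op b k p₂ ≡ not o →
            p ≡ o × p₁ ≡ not o × p₂ ≡ not o
op-cancel true  o     true  e e₁ e₂ = e , e₁ , e₂
op-cancel false o     false e e₁ e₂ = e , e₁ , e₂
op-cancel true  true  false () _ _
op-cancel true  false false _ () _
op-cancel false true  true  _ () _
op-cancel false false true  () _ _

-- Where `x` and `y` meet, the value `not o` forces both arguments to `not o`. Each argument misses
-- `x` or `y` and so keeps that value at the corner, against `corner`. Above this node, the argument
-- without `x` and `y` is constant over the three assignments and has to be the unit.
Meet-Shows : ∀ o {x y t} → Ok P t → Meet (not o) x y t → ¬ Shows o x y (λ α → ev α t)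
Meet-Shows o {x} {y} (nd {s = s} {t = u} p q d) m (shows {α} {αˣ} {αʸ} ax ay c nx ny) = refute m
  where
  sameˣ : ∀ {v} → ¬ x ∈ᵗ v → ev α v ≡ ev αˣ v
  sameˣ {v} n = ev-cong v λ {w} i → ax w λ { refl → n i }
  sameʸ : ∀ {v} → ¬ y ∈ᵗ v → ev α v ≡ ev αʸ v
  sameʸ {v} n = ev-cong v λ {w} i → ay w λ { refl → n i }
  differ : ∀ o {a b} → a ≡ not o → b ≡ not o → op (not o) a b ≢ o
  differ true  refl refl ()
  differ false refl refl ()
  refute : Meet (not o) x y (nd _ s u) → Empty
  refute (meet i j) = differ o
    (trans (sameʸ λ k → d k j) (proj₁ (op-unit (not o) ny)))
    (trans (sameˣ λ k → d i k) (proj₂ (op-unit (not o) nx))) c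
  refute (meet′ j i) = differ o
    (trans (sameˣ λ k → d k i) (proj₁ (op-unit (not o) nx)))
    (trans (sameʸ λ k → d j k) (proj₂ (op-unit (not o) ny))) c
  refute (inˡ {b = b} m′) with Meet-∈ m′
  ... | i , j with op-cancel b o (ev α u) {ev α s} (trans (op-comm b _ _) c)
        (trans (cong (λ k → op b k _) (sameˣ λ k → d i k)) (trans (op-comm b _ _) nx))
        (trans (cong (λ k → op b k _) (sameʸ λ k → d j k)) (trans (op-comm b _ _) ny))
  ...   | c′ , nx′ , ny′ = Meet-Shows o p m′ (shows ax ay c′ nx′ ny′)
  refute (inʳ {b = b} m′) with Meet-∈ m′
  ... | i , j with op-cancel b o (ev α s) {ev α u} c
        (trans (cong (λ k → op b k _) (sameˣ λ k → d k i)) nx)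
        (trans (cong (λ k → op b k _) (sameʸ λ k → d k j)) ny)
  ...   | c′ , nx′ , ny′ = Meet-Shows o q m′ (shows ax ay c′ nx′ ny′)

-- A meet is thereby detected from the function alone, and survives any passage to another linear
-- tree with the same function.
Shows-Meet : ∀ o {x y t} → Ok P t → x ≢ y → Shows o x y (λ α → ev α t) → Meet o x y t
Shows-Meet o {t = t} p n sh
  with o | sh | meets (proj₁ (Shows-∈ {t = t} sh)) (proj₂ (Shows-∈ {t = t} sh)) n
... | true  | _   | inj₁ m = m
... | true  | sh′ | inj₂ m = ⊥-elim (Meet-Shows true p m sh′)
... | false | sh′ | inj₁ m = ⊥-elim (Meet-Shows false p m sh′)
... | false | _   | inj₂ m = m

-- Formulae and rewriting steps

ShowsF : Bool → ℕ → ℕ → Formula → Set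
ShowsF o x y χ = Shows o x y (λ α → eval α χ)

signed-shows : ∀ σ → Shows o x y (λ α → eval α (⟦ t ⟧ σ)) → Shows o x y (λ α → ev α t)
signed-shows {t = t} σ (shows ax ay c nx ny) = shows
  (λ z n → cong (signed (σ z)) (ax z n)) (λ z n → cong (signed (σ z)) (ay z n))
  (trans (sym (⟦⟧-eval _ σ t)) c) (trans (sym (⟦⟧-eval _ σ t)) nx) (trans (sym (⟦⟧-eval _ σ t)) ny)

tree-shows : ∀ {χ V} → χ LinearOn V → ShowsF o x y χ → Shows o x y (λ α → ev α (tree χ))
tree-shows {o} {x} {y} {χ} p sh with signs p
... | σ , e = signed-shows {t = tree χ} σ (subst (ShowsF o x y) (sym e) sh)

-- A switch keeps every meet in ∨ and a medial every meet in ∧.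
data Redex : Bool → Rel Formula 0ℓ where
  switch : ∀ φ ψ χ → Redex false (φ ∧ (ψ ∨ χ)) ((φ ∧ ψ) ∨ χ)
  medial : ∀ φ ψ χ ω → Redex true ((φ ∧ ψ) ∨ (χ ∧ ω)) ((φ ∨ χ) ∧ (ψ ∨ ω))
  ∧ˡ     : ∀ {φ ψ χ} → Redex b φ ψ → Redex b (φ ∧ χ) (ψ ∧ χ)
  ∧ʳ     : ∀ {φ ψ χ} → Redex b φ ψ → Redex b (χ ∧ φ) (χ ∧ ψ)
  ∨ˡ     : ∀ {φ ψ χ} → Redex b φ ψ → Redex b (φ ∨ χ) (ψ ∨ χ)
  ∨ʳ     : ∀ {φ ψ χ} → Redex b φ ψ → Redex b (χ ∨ φ) (χ ∨ ψ)

Redex-subst : ∀ {φ ψ} σ → Redex b φ ψ → Redex b (φ ⟨ σ ⟩) (ψ ⟨ σ ⟩)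
Redex-subst σ (switch φ ψ χ)   = switch (φ ⟨ σ ⟩) (ψ ⟨ σ ⟩) (χ ⟨ σ ⟩)
Redex-subst σ (medial φ ψ χ ω) = medial (φ ⟨ σ ⟩) (ψ ⟨ σ ⟩) (χ ⟨ σ ⟩) (ω ⟨ σ ⟩)
Redex-subst σ (∧ˡ e) = ∧ˡ (Redex-subst σ e)
Redex-subst σ (∧ʳ e) = ∧ʳ (Redex-subst σ e)
Redex-subst σ (∨ˡ e) = ∨ˡ (Redex-subst σ e)
Redex-subst σ (∨ʳ e) = ∨ʳ (Redex-subst σ e)

-- Instances may be taken of steps already inside a context; since redexes survive substitution,
-- each step is one switch or one medial in a context.
step-redex : ∀ {φ ψ} → Step SwitchMedial φ ψ → ∃ λ b → Redex b φ ψ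
step-redex (rule _ switch)    = _ , switch _ _ _
step-redex (rule _ medial)    = _ , medial _ _ _ _
step-redex (inst σ _ _ _ e)   = _ , Redex-subst σ (proj₂ (step-redex e))
step-redex (∧-ctxˡ _ _ e) = _ , ∧ˡ (proj₂ (step-redex e))
step-redex (∧-ctxʳ _ _ e) = _ , ∧ʳ (proj₂ (step-redex e))
step-redex (∨-ctxˡ _ _ e) = _ , ∨ˡ (proj₂ (step-redex e))
step-redex (∨-ctxʳ _ _ e) = _ , ∨ʳ (proj₂ (step-redex e))

redex-∈ : ∀ {φ ψ} → Redex b φ ψ → x ∈ᵗ tree φ → x ∈ᵗ tree ψ
redex-∈ (switch _ _ _) (inˡ i)       = inˡ (inˡ i)
redex-∈ (switch _ _ _) (inʳ (inˡ i)) = inˡ (inʳ i)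
redex-∈ (switch _ _ _) (inʳ (inʳ i)) = inʳ i
redex-∈ (medial _ _ _ _) (inˡ (inˡ i)) = inˡ (inˡ i)
redex-∈ (medial _ _ _ _) (inˡ (inʳ i)) = inʳ (inˡ i)
redex-∈ (medial _ _ _ _) (inʳ (inˡ i)) = inˡ (inʳ i)
redex-∈ (medial _ _ _ _) (inʳ (inʳ i)) = inʳ (inʳ i)
redex-∈ (∧ˡ e) (inˡ i) = inˡ (redex-∈ e i)
redex-∈ (∧ˡ e) (inʳ i) = inʳ i
redex-∈ (∧ʳ e) (inˡ i) = inˡ i
redex-∈ (∧ʳ e) (inʳ i) = inʳ (redex-∈ e i)
redex-∈ (∨ˡ e) (inˡ i) = inˡ (redex-∈ e i)
redex-∈ (∨ˡ e) (inʳ i) = inʳ i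
redex-∈ (∨ʳ e) (inˡ i) = inˡ i
redex-∈ (∨ʳ e) (inʳ i) = inʳ (redex-∈ e i)

left-meet : (∀ {z} → z ∈ᵗ s → z ∈ᵗ s′) → (Meet o x y s → Meet o x y s′) →
            Meet o x y (nd b s t) → Meet o x y (nd b s′ t)
left-meet f g (meet i j)  = meet (f i) j
left-meet f g (meet′ j i) = meet′ (f j) i
left-meet f g (inˡ m)     = inˡ (g m)
left-meet f g (inʳ m)     = inʳ m

right-meet : (∀ {z} → z ∈ᵗ t → z ∈ᵗ t′) → (Meet o x y t → Meet o x y t′) →
             Meet o x y (nd b s t) → Meet o x y (nd b s t′)
right-meet f g (meet i j)  = meet i (f j)
right-meet f g (meet′ j i) = meet′ j (f i)
right-meet f g (inˡ m)     = inˡ m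
right-meet f g (inʳ m)     = inʳ (g m)

redex-meet : ∀ {φ ψ} → Redex b φ ψ → Meet b x y (tree φ) → Meet b x y (tree ψ)
redex-meet (switch _ _ _) (inˡ m)             = inˡ (inˡ m)
redex-meet (switch _ _ _) (inʳ (meet i j))    = meet (inʳ i) j
redex-meet (switch _ _ _) (inʳ (meet′ j i))   = meet′ (inʳ j) i
redex-meet (switch _ _ _) (inʳ (inˡ m))       = inˡ (inʳ m)
redex-meet (switch _ _ _) (inʳ (inʳ m))       = inʳ m
redex-meet (medial _ _ _ _) (inˡ (meet i j))  = meet (inˡ i) (inˡ j)
redex-meet (medial _ _ _ _) (inˡ (meet′ j i)) = meet′ (inˡ j) (inˡ i)
redex-meet (medial _ _ _ _) (inˡ (inˡ m))     = inˡ (inˡ m)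
redex-meet (medial _ _ _ _) (inˡ (inʳ m))     = inʳ (inˡ m)
redex-meet (medial _ _ _ _) (inʳ (meet i j))  = meet (inʳ i) (inʳ j)
redex-meet (medial _ _ _ _) (inʳ (meet′ j i)) = meet′ (inʳ j) (inʳ i)
redex-meet (medial _ _ _ _) (inʳ (inˡ m))     = inˡ (inʳ m)
redex-meet (medial _ _ _ _) (inʳ (inʳ m))     = inʳ (inʳ m)
redex-meet (∧ˡ e) = left-meet (redex-∈ e) (redex-meet e)
redex-meet (∧ʳ e) = right-meet (redex-∈ e) (redex-meet e)
redex-meet (∨ˡ e) = left-meet (redex-∈ e) (redex-meet e)
redex-meet (∨ʳ e) = right-meet (redex-∈ e) (redex-meet e)

-- Soundness

eval-dual : ∀ α φ → eval α (dual φ) ≡ not (eval α φ)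
eval-dual α ⊤       = refl
eval-dual α ⊥       = refl
eval-dual α (var x) = refl
eval-dual α (neg x) = sym (𝔹ₚ.not-involutive (α x))
eval-dual α (φ ∧ ψ) = trans (cong₂ _||_ (eval-dual α φ) (eval-dual α ψ)) (op-not true (eval α φ) (eval α ψ))
eval-dual α (φ ∨ ψ) = trans (cong₂ _&&_ (eval-dual α φ) (eval-dual α ψ)) (op-not false (eval α φ) (eval α ψ))

eval-subst : ∀ α σ φ → eval α (φ ⟨ σ ⟩) ≡ eval (λ x → eval α (σ x)) φ
eval-subst α σ ⊤       = refl
eval-subst α σ ⊥       = refl
eval-subst α σ (var x) = refl
eval-subst α σ (neg x) = eval-dual α (σ x)
eval-subst α σ (φ ∧ ψ) = cong₂ _&&_ (eval-subst α σ φ) (eval-subst α σ ψ)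
eval-subst α σ (φ ∨ ψ) = cong₂ _||_ (eval-subst α σ φ) (eval-subst α σ ψ)

step-sound : ∀ {T φ ψ} → Step T φ ψ → φ ⊨ ψ
step-sound (rule (_ , _ , h) _) = h
step-sound (inst {φ} {ψ} σ _ _ _ e) α h =
  trans (eval-subst α σ ψ) (step-sound e _ (trans (sym (eval-subst α σ φ)) h))
step-sound (∧-ctxˡ _ _ e) α = op-mono true (step-sound e α) id
step-sound (∧-ctxʳ {χ = χ} _ _ e) α = op-mono true {eval α χ} id (step-sound e α)
step-sound (∨-ctxˡ {φ} _ _ e) α = op-mono false {eval α φ} (step-sound e α) id
step-sound (∨-ctxʳ {χ = χ} _ _ e) α = op-mono false {eval α χ} id (step-sound e α)

congruence-sound : ∀ {T : Rel Formula 0ℓ} → (∀ {φ ψ} → T φ ψ → ∀ α → eval α φ ≡ eval α ψ) →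
                   ∀ {φ ψ} → Congruence T φ ψ → ∀ α → eval α φ ≡ eval α ψ
congruence-sound f (base _ _ e)    α = f e α
congruence-sound f (reflex _)      α = refl
congruence-sound f (symm e)        α = sym (congruence-sound f e α)
congruence-sound f (transit d e)   α = trans (congruence-sound f d α) (congruence-sound f e α)
congruence-sound f (∧-congˡ _ _ e) α = cong (_&& _) (congruence-sound f e α)
congruence-sound f (∧-congʳ {χ = χ} _ _ e) α = cong (eval α χ &&_) (congruence-sound f e α)
congruence-sound f (∨-congˡ _ _ e) α = cong (_|| _) (congruence-sound f e α)
congruence-sound f (∨-congʳ {χ = χ} _ _ e) α = cong (eval α χ ||_) (congruence-sound f e α)

ac-sound : ∀ {φ ψ} → ACAxiom φ ψ → ∀ α → eval α φ ≡ eval α ψ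
ac-sound (∧-comm φ ψ)    α = op-comm true (eval α φ) _
ac-sound (∨-comm φ ψ)    α = op-comm false (eval α φ) _
ac-sound (∧-assoc φ ψ χ) α = op-assoc true (eval α φ) _ _
ac-sound (∨-assoc φ ψ χ) α = op-assoc false (eval α φ) _ _

unit-sound : ∀ {φ ψ} → UnitAxiom φ ψ → ∀ α → eval α φ ≡ eval α ψ
unit-sound (∧-⊤ʳ φ) α = 𝔹ₚ.∧-identityʳ _
unit-sound (∧-⊤ˡ φ) α = refl
unit-sound (∨-⊥ʳ φ) α = 𝔹ₚ.∨-identityʳ _
unit-sound (∨-⊥ˡ φ) α = refl
unit-sound (∧-⊥ʳ φ) α = 𝔹ₚ.∧-zeroʳ _
unit-sound (∧-⊥ˡ φ) α = refl
unit-sound (∨-⊤ʳ φ) α = 𝔹ₚ.∨-zeroʳ _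
unit-sound (∨-⊤ˡ φ) α = refl

acu-sound : ∀ {φ ψ} → φ ∼acu ψ → ∀ α → eval α φ ≡ eval α ψ
acu-sound = congruence-sound [ congruence-sound ac-sound , congruence-sound unit-sound ]′

congruence-linear : ∀ {T : Rel Formula 0ℓ} {φ ψ} → Congruence T φ ψ → Linear φ × Linear ψ
congruence-linear (base p q _)    = p , q
congruence-linear (reflex p)      = p , p
congruence-linear (symm e)        = proj₂ (congruence-linear e) , proj₁ (congruence-linear e)
congruence-linear (transit d e)   = proj₁ (congruence-linear d) , proj₂ (congruence-linear e)
congruence-linear (∧-congˡ p q _) = p , q
congruence-linear (∧-congʳ p q _) = p , q
congruence-linear (∨-congˡ p q _) = p , q
congruence-linear (∨-congʳ p q _) = p , q

derivable-sound : ∀ {T φ ψ} → DerivableWithUnits T φ ψ → φ ⊨ ψ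
derivable-sound ε α h = h
derivable-sound (inj₁ (_ , _ , d , e , f) ◅ k) α h =
  derivable-sound k α (trans (sym (acu-sound f α)) (step-sound e α (trans (sym (acu-sound d α)) h)))
derivable-sound (inj₂ d ◅ k) α h = derivable-sound k α (trans (sym (acu-sound d α)) h)

-- The inference on eight variables

-- The pair is self-dual: exchanging 1 with 3, 2 with 6 and 4 with 7 turns `φ₈` into the dual of
-- `ψ₈`, up to commutativity.
φ₈ ψ₈ : Tree
φ₈ = nd true (nd false (nd true (at 3) (at 4)) (nd true (at 5) (nd false (at 6) (at 7))))
             (nd false (at 0) (nd true (at 1) (at 2)))
ψ₈ = nd false (nd true (nd false (at 1) (at 7)) (nd false (nd true (at 2) (at 4)) (at 5)))
              (nd true (nd false (at 3) (at 6)) (at 0))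

-- Lower bounds are tested at `implicants`, with all else false. Upper bounds are tested dually:
-- making one member of `implicates` false and all else true turns `ψ₈` false.
implicants implicates : List (List ℕ)
implicants = minterms φ₈
implicates = minterms (dualᵗ ψ₈)

allFalse : List (List ℕ) → Tree → Bool
allFalse Ms t = every (λ M → not (ev (not ∘ occurs M) t)) Ms

-- A conjunction above `φ₈` has both conjuncts above it, and a disjunction below `ψ₈` both disjuncts
-- below it. So each argument can be discarded by itself, before any pairs are formed.
fits : Bool → Tree → Bool
fits true  = allTrue implicants
fits false = allFalse implicates

settled : Tree → Bool
settled t = not (allTrue implicants t) || (not (allFalse implicates t) ||
            (allTrue (minterms t) φ₈ || allTrue (minterms ψ₈) t))

pairs : Bool → (Tree → Tree → Tree) → List Tree → List Tree → Bool
pairs o node ss ts =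
  every (λ s → not (fits o s) || every (λ t → not (fits o t) || settled (node s t)) ts) ss

-- The shorter list comes first: usually nothing in it fits, and then the
-- longer one is never computed.
pairsBy : Bool → Bool → List Tree → List Tree → Bool
pairsBy true  o cs rs = pairs o (λ c r → nd o c r) cs rs
pairsBy false o cs rs = pairs o (λ r c → nd o c r) rs cs

-- This covers the trees of `Labelled.rooted (suc k) o (x ∷ xs)` without building that list, so that
-- the arguments can be filtered before they are combined.
search : ℕ → Bool → ℕ → List ℕ → Bool
search k o x xs =
  every (λ p → pairsBy (length (proj₁ p) <ᵇ length (proj₂ p)) o
                 (Labelled.component k (not o) (x ∷ proj₁ p)) (Labelled.trees k (proj₂ p)))
        (splits xs)

abstract
  search-true : ∀ o → search 7 o 0 (1 ∷ 2 ∷ 3 ∷ 4 ∷ 5 ∷ 6 ∷ 7 ∷ []) ≡ true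
  search-true true  = refl
  search-true false = refl

implicates-false : t ≤ᵗ ψ₈ → ∀ {M} → M ∈ implicates → ev (not ∘ occurs M) t ≡ false
implicates-false {t} t≤ψ {M} i with ev (not ∘ occurs M) t in q
... | false = refl
... | true with trans (sym (minterm-true (dualᵗ ψ₈) i))
             (trans (ev-dual (occurs M) ψ₈) (cong not (t≤ψ (not ∘ occurs M) q)))
...   | ()

allFalse-below : t ≤ᵗ ψ₈ → allFalse implicates t ≡ true
allFalse-below {t} t≤ψ = every-all implicates λ i → cong not (implicates-false {t} t≤ψ i)

modusPonens : ∀ {a b} → not a || b ≡ true → a ≡ true → b ≡ true
modusPonens h refl = h

module _ {t : Tree} (φ≤t : φ₈ ≤ᵗ t) (t≤ψ : t ≤ᵗ ψ₈) where

  settled-sound : settled t ≡ true → t ≤ᵗ φ₈ ⊎ ψ₈ ≤ᵗ t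
  settled-sound q with ||-true {allTrue (minterms t) φ₈}
    (modusPonens (modusPonens q (allTrue-complete φ₈ t φ≤t)) (allFalse-below {t} t≤ψ))
  ... | inj₁ u = inj₁ (allTrue-sound t φ₈ u)
  ... | inj₂ v = inj₂ (allTrue-sound ψ₈ t v)

fits-both : ∀ o {s t} → φ₈ ≤ᵗ nd o s t → nd o s t ≤ᵗ ψ₈ → fits o s ≡ true × fits o t ≡ true
fits-both true {s} {t} p q =
  allTrue-complete φ₈ s (λ β k → op-trueˡ (p β k)) ,
  allTrue-complete φ₈ t (λ β k → op-trueʳ {ev β s} (p β k))
fits-both false {s} {t} p q =
  allFalse-below {s} (λ β k → q β (||-trueˡ (ev β t) k)) ,
  allFalse-below {t} (λ β k → q β (||-trueʳ (ev β s) k))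

pairsBy-sound : ∀ b o {cs rs c r} → pairsBy b o cs rs ≡ true → c ∈ cs → r ∈ rs →
                fits o c ≡ true → fits o r ≡ true → settled (nd o c r) ≡ true
pairsBy-sound true  o q i j u v = modusPonens (every-∈ (modusPonens (every-∈ q i) u) j) v
pairsBy-sound false o q i j u v = modusPonens (every-∈ (modusPonens (every-∈ q j) v) i) u

search-sound : ∀ k o x xs {t} → search k o x xs ≡ true → t ∈ Labelled.rooted (suc k) o (x ∷ xs) →
               φ₈ ≤ᵗ t → t ≤ᵗ ψ₈ → t ≤ᵗ φ₈ ⊎ ψ₈ ≤ᵗ t
search-sound k o x xs q i φ≤t t≤ψ
  with find (∈ₚ.∈-concatMap⁻ (λ p → cartesianProductWith (λ r c → nd o c r) (Labelled.trees k (proj₂ p))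
                                      (Labelled.component k (not o) (x ∷ proj₁ p))) {xs = splits xs} i)
... | (as , bs) , j , l with ∈ₚ.∈-cartesianProductWith⁻ (λ r c → nd o c r) (Labelled.trees k bs) _ l
... | r , c , m , n , refl with fits-both o {c} {r} φ≤t t≤ψ
... | u , v = settled-sound {nd o c r} φ≤t t≤ψ
  (pairsBy-sound (length as <ᵇ length bs) o (every-∈ q j) n m u v)

between-nd : ∀ k x xs {o s t} → length xs ≤ k → (∀ o → search k o x xs ≡ true) → On (nd o s t) (x ∷ xs) →
             φ₈ ≤ᵗ nd o s t → nd o s t ≤ᵗ ψ₈ → nd o s t ≤ᵗ φ₈ ⊎ ψ₈ ≤ᵗ nd o s t
between-nd k x xs {o} len q p φ≤t t≤ψ with LabelledComplete.rooted-complete (suc k) (s≤s len) p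
... | s′ , t′ , i , h with search-sound k o x xs (q o) i
  (λ β e → trans (sym (≈-ev β h)) (φ≤t β e)) (λ β e → t≤ψ β (trans (≈-ev β h) e))
... | inj₁ u = inj₁ λ β e → u β (trans (sym (≈-ev β h)) e)
... | inj₂ v = inj₂ λ β e → trans (≈-ev β h) (v β e)

-- Setting x in the context essential x turns φ₈ true, and leaving it out
-- leaves ψ₈ false.
essential : ℕ → List ℕ
essential 0 = 3 ∷ 4 ∷ []
essential 1 = 2 ∷ 3 ∷ 4 ∷ []
essential 2 = 1 ∷ 3 ∷ 4 ∷ []
essential 3 = 0 ∷ 4 ∷ []
essential 4 = 1 ∷ 2 ∷ 3 ∷ []
essential 5 = 0 ∷ 7 ∷ []
essential _ = 0 ∷ 5 ∷ []

raises lowers : ℕ → Bool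
raises x = ev (occurs (x ∷ essential x)) φ₈
lowers x = not (ev (occurs (essential x)) ψ₈)

raises-all : every raises (upTo 8) ≡ true
raises-all = refl

lowers-all : every lowers (upTo 8) ≡ true
lowers-all = refl

occurs-∷ : x ≢ y → ∀ N → occurs (y ∷ N) x ≡ occurs N x
occurs-∷ {x} {y} n N = cong (_|| occurs N x) (dec-false (x ≟ y) n)

-- A tree without `x` has the same value at both assignments, but `φ₈` forces it true at one and
-- `ψ₈` forces it false at the other.
all-occur : ∀ {x t} → φ₈ ≤ᵗ t → t ≤ᵗ ψ₈ → x ∈ upTo 8 → x ∈ᵗ t
all-occur {x} {t} φ≤t t≤ψ i with x ∈ᵗ? t
... | yes j = j
... | no ¬j with trans (sym (every-∈ {p = lowers} lowers-all i)) (cong not (t≤ψ (occurs N) true-at-N))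
  where
  N = essential x
  true-at-N : ev (occurs N) t ≡ true
  true-at-N = trans
    (sym (ev-cong t λ {y} k → occurs-∷ {y} {x} (λ { refl → ¬j k }) N))
    (φ≤t (occurs (x ∷ N)) (every-∈ {p = raises} raises-all i))
... | ()

between : On t (upTo 8) → φ₈ ≤ᵗ t → t ≤ᵗ ψ₈ → t ≤ᵗ φ₈ ⊎ ψ₈ ≤ᵗ t
between {cst b} o with On.const-free o
... | ()
between {at x} o φ≤t t≤ψ with all-occur {x = 0} {at x} φ≤t t≤ψ (Any.here refl)
                                | all-occur {x = 1} {at x} φ≤t t≤ψ (Any.there (Any.here refl))
... | here | ()
between {nd o s t} p = between-nd 7 0 (1 ∷ 2 ∷ 3 ∷ 4 ∷ 5 ∷ 6 ∷ 7 ∷ []) ℕₚ.≤-refl search-true p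

F₈ G₈ : Formula
F₈ = ⟦ φ₈ ⟧ (λ _ → true)
G₈ = ⟦ ψ₈ ⟧ (λ _ → true)

F₈-eval : ∀ α → eval α F₈ ≡ ev α φ₈
F₈-eval α = ⟦⟧-eval α (λ _ → true) φ₈

G₈-eval : ∀ α → eval α G₈ ≡ ev α ψ₈
G₈-eval α = ⟦⟧-eval α (λ _ → true) ψ₈

≤ᵗ-antisym : s ≤ᵗ t → t ≤ᵗ s → ∀ β → ev β s ≡ ev β t
≤ᵗ-antisym {s} {t} s≤t t≤s β with ev β s in p | ev β t in q
... | true  | true  = refl
... | false | false = refl
... | true  | false = trans (sym (s≤t β p)) q
... | false | true  = trans (sym p) (t≤s β q)

Normal-between : Normal t → φ₈ ≤ᵗ t → t ≤ᵗ ψ₈ → ConstFree t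
Normal-between (free f)      φ≤t t≤ψ = f
Normal-between (const true)  φ≤t t≤ψ with t≤ψ (λ _ → false) refl
... | ()
Normal-between (const false) φ≤t t≤ψ with φ≤t (λ _ → true) refl
... | ()

vars<8 : every (_<ᵇ 8) (vars ψ₈) ≡ true
vars<8 = refl

shows-and : ∀ t x y N → ev (occurs (x ∷ y ∷ N)) t ≡ true → ev (occurs (y ∷ N)) t ≡ false →
            ev (occurs (x ∷ N)) t ≡ false → Shows true x y (λ β → ev β t)
shows-and t x y N = shows (λ z n → occurs-∷ n (y ∷ N)) (λ z n → cong ((z ≡ᵇ x) ||_) (occurs-∷ n N))

shows-or : ∀ t x y N → ev (occurs N) t ≡ false → ev (occurs (x ∷ N)) t ≡ true →
           ev (occurs (y ∷ N)) t ≡ true → Shows false x y (λ β → ev β t)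
shows-or t x y N = shows (λ z n → sym (occurs-∷ n N)) (λ z n → sym (occurs-∷ n N))

Shows-resp : ∀ {p q : Assignment → Bool} → (∀ α → p α ≡ q α) → Shows o x y p → Shows o x y q
Shows-resp e (shows ax ay c nx ny) =
  shows ax ay (trans (sym (e _)) c) (trans (sym (e _)) nx) (trans (sym (e _)) ny)

-- The two sides of the inference differ at the pairs 0, 4 and 4, 7.
LikeF LikeG : (Assignment → Bool) → Set
LikeF p = Shows true  0 4 p × Shows false 4 7 p
LikeG p = Shows false 0 4 p × Shows true  4 7 p

-- With 3 true and the rest false, `φ₈` reduces to `0 ∧ 4`; with 0, 3 and 5 true, to `4 ∨ 7`.
φ₈-like : LikeF (λ β → ev β φ₈)
φ₈-like = shows-and φ₈ 0 4 (3 ∷ []) refl refl refl , shows-or φ₈ 4 7 (0 ∷ 3 ∷ 5 ∷ []) refl refl refl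

-- With 1, 2 and 3 true and the rest false, `ψ₈` reduces to `0 ∨ 4`; with only 2 true, to `4 ∧ 7`.
ψ₈-like : LikeG (λ β → ev β ψ₈)
ψ₈-like = shows-or ψ₈ 0 4 (1 ∷ 2 ∷ 3 ∷ []) refl refl refl , shows-and ψ₈ 4 7 (2 ∷ []) refl refl refl

-- Arbitrary linear formulae between the two sides

module _ {χ : Formula} {V : VarSet} (p : χ LinearOn V) (F⊨χ : F₈ ⊨ χ) (χ⊨G : χ ⊨ G₈) where

  private
    σ  = proj₁ (signs p)
    eσ = proj₂ (signs p)

    K : ℕ → Bool
    K x = (x <ᵇ 8) && σ x

    core : Tree
    core = restr K true (tree χ)

    -- All literals other than the variables 0, …, 7 are made true.
    extend : Assignment → Assignment
    extend β x = if K x then β x else σ x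

    χ-eval : ∀ α → eval α χ ≡ ev (λ x → signed (σ x) (α x)) (tree χ)
    χ-eval α = trans (cong (eval α) (sym eσ)) (⟦⟧-eval α σ (tree χ))

    extend-eval : ∀ β → eval (extend β) χ ≡ ev β core
    extend-eval β = trans (χ-eval (extend β))
      (trans (ev-cong (tree χ) λ {x} _ → literals x) (sym (restr-ev β K true (tree χ))))
      where
      literals : ∀ x → signed (σ x) (extend β x) ≡ (if K x then β x else true)
      literals x with x <ᵇ 8 | σ x
      ... | true  | true  = refl
      ... | true  | false = refl
      ... | false | true  = refl
      ... | false | false = refl

    φ≤core : φ₈ ≤ᵗ core
    φ≤core β e = trans (restr-ev β K true (tree χ)) (ev-mono (tree χ) (λ {x} _ → raise x)
      (trans (sym (χ-eval β)) (F⊨χ β (trans (F₈-eval β) e))))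
      where
      raise : ∀ x → signed (σ x) (β x) ≡ true → (if K x then β x else true) ≡ true
      raise x h with x <ᵇ 8 | σ x
      ... | true  | true  = h
      ... | true  | false = refl
      ... | false | _     = refl

    -- A negative literal is made true by making its variable false, so on `0`, ..., `7` the
    -- assignment `extend β` never exceeds `β`, and `ψ₈` is monotone.
    core≤ψ : core ≤ᵗ ψ₈
    core≤ψ β e = ev-mono ψ₈ (λ {x} i → lower x (every-∈ {p = _<ᵇ 8} vars<8 (∈-vars i)))
      (trans (sym (G₈-eval (extend β))) (χ⊨G (extend β) (trans (extend-eval β) e)))
      where
      lower : ∀ x → (x <ᵇ 8) ≡ true → extend β x ≡ true → β x ≡ true
      lower x i h rewrite i with σ x
      lower x i h  | true  = h
      lower x i () | false

    core-on : On core (upTo 8)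
    core-on = on (Ok-self (restr-Ok (tree-Ok p)))
      (Normal-between (restr-Normal K true (tree χ)) φ≤core core≤ψ) (Uniq.upTo⁺ 8)
      (λ {x} i → ∈ₚ.∈-upTo⁺ (ℕₚ.<ᵇ⇒< x 8 (subst T (sym (proj₁ (&&-true (proj₂ (restr-∈ (tree χ) i))))) tt)))
      (all-occur φ≤core core≤ψ)

    extend-Shows : Shows o x y (λ β → ev β core) → Shows o x y (λ α → eval α χ)
    extend-Shows (shows ax ay c nx ny) = shows
      (λ z n → cong (λ b → if K z then b else σ z) (ax z n)) (λ z n → cong (λ b → if K z then b else σ z) (ay z n))
      (trans (extend-eval _) c) (trans (extend-eval _) nx) (trans (extend-eval _) ny)

    inherit : ∀ t → (∀ β → ev β t ≡ ev β core) → Shows o x y (λ β → ev β t) → Shows o x y (λ α → eval α χ)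
    inherit t e = extend-Shows ∘ Shows-resp e

  dichotomy : LikeF (λ α → eval α χ) ⊎ LikeG (λ α → eval α χ)
  dichotomy with between core-on φ≤core core≤ψ
  ... | inj₁ h = inj₁ (inherit φ₈ e (proj₁ φ₈-like) , inherit φ₈ e (proj₂ φ₈-like))
    where e = ≤ᵗ-antisym {φ₈} {core} φ≤core h
  ... | inj₂ h = inj₂ (inherit ψ₈ e (proj₁ ψ₈-like) , inherit ψ₈ e (proj₂ ψ₈-like))
    where e = ≤ᵗ-antisym {ψ₈} {core} h core≤ψ

-- Impossibility of a derivation

meets-at : ∀ o {χ} → Linear χ → x ≢ y → Shows o x y (λ α → eval α χ) → Meet o x y (tree χ)
meets-at o (_ , p) n s = Shows-Meet o (tree-Ok p) n (tree-shows p s)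

not-meets-at : ∀ o {χ} → Linear χ → Shows o x y (λ α → eval α χ) → ¬ Meet (not o) x y (tree χ)
not-meets-at o (_ , p) s m = Meet-Shows o (tree-Ok p) m (tree-shows p s)

exclusive : ∀ {χ} → Linear χ → LikeF (λ α → eval α χ) → ¬ LikeG (λ α → eval α χ)
exclusive l (s , _) (s′ , _) = not-meets-at false l s′ (meets-at true l (λ ()) s)

no-step : ∀ {χ ω} → Linear χ → Linear ω → Step SwitchMedial χ ω →
          LikeF (λ α → eval α χ) → ¬ LikeG (λ α → eval α ω)
no-step l m e (s₁ , s₂) (t₁ , t₂) with step-redex e
... | true  , r = not-meets-at false m t₁ (redex-meet r (meets-at true l (λ ()) s₁))
... | false , r = not-meets-at true m t₂ (redex-meet r (meets-at false l (λ ()) s₂))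

disjoint? : ∀ s t → Dec (∀ {x} → x ∈ᵗ s → ¬ x ∈ᵗ t)
disjoint? (cst b) t = yes λ ()
disjoint? (at x) t with x ∈ᵗ? t
... | yes i = no λ d → d here i
... | no ¬i = yes λ { here → ¬i }
disjoint? (nd o r s) t with disjoint? r t | disjoint? s t
... | yes d | yes e = yes λ { (inˡ i) → d i ; (inʳ i) → e i }
... | no ¬d | _     = no λ f → ¬d (f ∘ inˡ)
... | _     | no ¬e = no λ f → ¬e (f ∘ inʳ)

linear? : ∀ t → Dec (Ok (λ _ → Unit) t)
linear? (cst b) = yes cst
linear? (at x)  = yes (at tt)
linear? (nd o s t) with linear? s | linear? t | disjoint? s t
... | yes p | yes q | yes d = yes (nd p q d)
... | no ¬p | _ | _ = no λ { (nd p _ _) → ¬p p }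
... | _ | no ¬q | _ = no λ { (nd _ q _) → ¬q q }
... | _ | _ | no ¬d = no λ { (nd _ _ d) → ¬d d }

V₈ : VarSet
V₈ = vars φ₈

F₈-on : F₈ LinearOn V₈
F₈-on = ⟦⟧-on (λ _ → true) (toWitness {a? = linear? φ₈} tt)

∨-on-resp : ∀ {φ ψ V W} → φ ∨ ψ LinearOn V → W ↭ V → φ ∨ ψ LinearOn W
∨-on-resp (∨-on p q d r) e = ∨-on p q d (↭-trans e r)

G₈-on : G₈ LinearOn V₈
G₈-on = ∨-on-resp (⟦⟧-on (λ _ → true) (toWitness {a? = linear? ψ₈} tt))
  -- `V₈` lists the leaves of `φ₈`; each shift brings the next leaf of `ψ₈` to the front.
  (↭-trans (↭ₚ.shift 1 (3 ∷ 4 ∷ 5 ∷ 6 ∷ 7 ∷ 0 ∷ []) (2 ∷ [])) (↭-prep 1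
  (↭-trans (↭ₚ.shift 7 (3 ∷ 4 ∷ 5 ∷ 6 ∷ []) (0 ∷ 2 ∷ [])) (↭-prep 7
  (↭-trans (↭ₚ.shift 2 (3 ∷ 4 ∷ 5 ∷ 6 ∷ 0 ∷ []) []) (↭-prep 2
  (↭-trans (↭ₚ.shift 4 (3 ∷ []) (5 ∷ 6 ∷ 0 ∷ [])) (↭-prep 4
  (↭ₚ.shift 5 (3 ∷ []) (6 ∷ 0 ∷ []))))))))))

F₈⊨G₈ : F₈ ⊨ G₈
F₈⊨G₈ α e = trans (G₈-eval α) (allTrue-sound φ₈ ψ₈ refl α (trans (sym (F₈-eval α)) e))

-- `LikeF` is an invariant of a derivation towards `G₈`: by soundness each formula lies between the
-- two sides, so `dichotomy` applies, while neither an equivalence nor a step can pass from `LikeF`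
-- to `LikeG`. The end `G₈` is `LikeG`.
stuck : ∀ {χ} → DerivableWithUnits SwitchMedial χ G₈ → Linear χ → F₈ ⊨ χ → ¬ LikeF (λ α → eval α χ)
stuck ε l h like = exclusive l like
  (Shows-resp (sym ∘ G₈-eval) (proj₁ ψ₈-like) , Shows-resp (sym ∘ G₈-eval) (proj₂ ψ₈-like))
stuck (inj₂ e ◅ k) l h like with congruence-linear e
... | _ , m@(_ , q) with dichotomy q (λ α → trans (sym (acu-sound e α)) ∘ h α) (derivable-sound k)
...   | inj₁ like′ = stuck k m (λ α → trans (sym (acu-sound e α)) ∘ h α) like′
...   | inj₂ (s , s′) = exclusive l like (Shows-resp (sym ∘ acu-sound e) s , Shows-resp (sym ∘ acu-sound e) s′)
stuck (inj₁ (χ₁ , χ₂ , e₁ , r , e₂) ◅ k) l h like@(s , s′) with congruence-linear e₁ | congruence-linear e₂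
... | _ , l₁ | l₂ , m@(_ , q)
  with dichotomy q (λ α → derivable-sound (inj₁ (χ₁ , χ₂ , e₁ , r , e₂) ◅ ε) α ∘ h α) (derivable-sound k)
...   | inj₁ like′ = stuck k m (λ α → derivable-sound (inj₁ (χ₁ , χ₂ , e₁ , r , e₂) ◅ ε) α ∘ h α) like′
...   | inj₂ (t , t′) = no-step l₁ l₂ r
  (Shows-resp (acu-sound e₁) s , Shows-resp (acu-sound e₁) s′)
  (Shows-resp (sym ∘ acu-sound e₂) t , Shows-resp (sym ∘ acu-sound e₂) t′)

F₈-not-derivable : ¬ DerivableWithUnits SwitchMedial F₈ G₈
F₈-not-derivable k = stuck k (_ , F₈-on) (λ _ → id)
  (Shows-resp (sym ∘ F₈-eval) (proj₁ φ₈-like) , Shows-resp (sym ∘ F₈-eval) (proj₂ φ₈-like))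

theorem2p9 : (∀ V₁ V₂ φ ψ → φ LinearOn V₁ → ψ LinearOn V₂ → φ ⊨ ψ →
    length (V₁ ∩ V₂) ≤ 7 → DerivableWithUnits SwitchMedial φ ψ)
    × (∃ λ V → ∃ λ φ → ∃ λ ψ →
    length V ≡ 8 × φ LinearOn V × ψ LinearOn V × φ ⊨ ψ ×
    ¬ DerivableWithUnits SwitchMedial φ ψ)
    × (∀ n →
    (∀ V₁ V₂ φ ψ → φ LinearOn V₁ → ψ LinearOn V₂ → φ ⊨ ψ →
    length (V₁ ∩ V₂) ≤ n → DerivableWithUnits SwitchMedial φ ψ) →
    n ≤ 7)
theorem2p9 =
  derivable-≤7 ,
  (V₈ , F₈ , G₈ , refl , F₈-on , G₈-on , F₈⊨G₈ , F₈-not-derivable) ,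
  -- `length (V₈ ∩ V₈)` computes to 8, so `8≤n` is the very bound that `derivable` asks for.
  λ n derivable → ℕₚ.≮⇒≥ λ 8≤n →
    F₈-not-derivable (derivable V₈ V₈ F₈ G₈ F₈-on G₈-on F₈⊨G₈ 8≤n)
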